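{- For $n\ge1$ and integer $k$, let $I^{\overline{B}}_{n,k}$ be the number of signed involutions $\pi\in\mathfrak{B}_n$ (i.e. $\pi^{ -1}=\pi$) with $\operatorname{des}^B(\pi)=k$ (so $I^{\overline{B}}_{n,k}=0$ for $k<0$). Then $I^{\overline{B}}_{1,0}=I^{\overline{B}}_{1,1}=1$, $I^{\overline{B}}_{2,0}=1$, $I^{\overline{B}}_{2,1}=4$, $I^{\overline{B}}_{2,2}=1$, and for all $n\ge3$ and $k\ge0$, \[ \begin{aligned} n I^{\overline{B}}_{n,k}={}&(2k+1)I^{\overline{B}}_{n-1,k}+(2n-2k+1)I^{\overline{B}}_{n-1,k-1}+\big(n-1+2k(k+1)\big)I^{\overline{B}}_{n-2,k}\\ &+\big(2(n-1)+4(n-k-1)(k-1)\big)I^{\overline{B}}_{n-2,k-1}\\ &+\big((2n-3)(n-1)+2(k-2)(k-2n+1)\big)I^{\overline{B}}_{n-2,k-2}. \end{aligned} \]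
   Context: $\mathfrak{B}_n$ is the set of signed permutations $\pi=\pi_1\cdots\pi_n$ ($\pi_i\in\{\pm1,\dots,\pm n\}$, $|\pi_1|,\dots,|\pi_n|$ a permutation of $[n]$), with $\pi_0=0$; the inverse is defined by $\pi^{ -1}_{|\pi_i|}=\operatorname{sgn}(\pi_i)\,i$. With the natural order on $\mathbb{Z}$, $\operatorname{des}^B(\pi)=|\{i\in\{0,\dots,n-1\}:\pi_i>\pi_{i+1}\}|$. -}

module Defs where

open import Data.Nat as ℕ using (ℕ; zero; suc)
open import Data.Integer as ℤ using (ℤ; +_; -_; ∣_∣; _<?_)
open import Data.Bool using (Bool; true; false; if_then_else_; _∧_; not)
open import Data.List using (List; []; _∷_; map; concatMap; length; filterᵇ; upTo)
open import Data.Bool.ListAction using (all; any)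
open import Relation.Nullary.Decidable using (⌊_⌋)

oneTo : ℕ → List ℕ
oneTo n = map suc (upTo n)

candidates : ℕ → List ℤ
candidates n = concatMap (λ j → + j ∷ - (+ j) ∷ []) (oneTo n)

words : ℕ → ℕ → List (List ℤ)
words n zero    = [] ∷ []
words n (suc m) = concatMap (λ w → map (_∷ w) (candidates n)) (words n m)

distinctℕ : List ℕ → Bool
distinctℕ []       = true
distinctℕ (x ∷ xs) = not (any (λ y → ⌊ x ℕ.≟ y ⌋) xs) ∧ distinctℕ xs

-- π is a signed permutation of [n] (given its entries lie in ±[n] and it has length n):
-- |π_1|, …, |π_n| is a permutation of [n]
isSignedPerm : List ℤ → Bool
isSignedPerm π = distinctℕ (map ∣_∣ π)

signedPerms : ℕ → List (List ℤ)
signedPerms n = filterᵇ isSignedPerm (words n n)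

-- π_i for 1 ≤ i ≤ n (1-based; returns 0 out of range)
at : List ℤ → ℕ → ℤ
at []       _             = + 0
at (x ∷ xs) zero          = + 0
at (x ∷ xs) (suc zero)    = x
at (x ∷ xs) (suc (suc i)) = at xs (suc i)

sgnMul : ℤ → ℕ → ℤ
sgnMul x i = if ⌊ x <? + 0 ⌋ then - (+ i) else + i

-- π⁻¹ = π.  By definition π⁻¹_{|π_i|} = sgn(π_i) i, and the |π_i| range over all of [n],
-- so π⁻¹ = π  iff  π_{|π_i|} = sgn(π_i) i  for every i ∈ [n].
isInvolution : List ℤ → Bool
isInvolution π = all (λ i → ⌊ at π ∣ at π i ∣ ℤ.≟ sgnMul (at π i) i ⌋) (oneTo (length π))

descents : List ℤ → ℕ
descents []           = 0
descents (x ∷ [])     = 0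
descents (x ∷ y ∷ ys) = (if ⌊ y <? x ⌋ then 1 else 0) ℕ.+ descents (y ∷ ys)

desB : List ℤ → ℕ
desB π = descents (+ 0 ∷ π)

IB : ℕ → ℤ → ℕ
IB n k = length (filterᵇ (λ π → isInvolution π ∧ ⌊ + desB π ℤ.≟ k ⌋) (signedPerms n))

{-# OPTIONS --safe #-}

-- Let A_n(r) be the number of pairs of a signed involution π of [n] and a colouring
-- 0 ≤ c₁ ≤ … ≤ cₙ ≤ r with c_i < c_{i+1} at the descents of π (and 0 < c₁ if π₁ < 0).  For a fixed π
-- the colourings have generating function t^{des π} / (1 - t)^{n+1} in r, so
-- Σ_r A_n(r) t^r = I_n(t) / (1 - t)^{n+1}.  On the other hand extend the colouring to an odd function
-- on ±[n] and record the multiset of the pairs (c_i , c_{π_i}), a multiset invariant under swapping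
-- and negating: it has 2 r + 1 orbits covering one i and r² orbits covering two, and it determines the
-- coloured involution.  Hence Σ_n A_n(r) u^n = (1 - u)^{-(2r+1)} (1 - u²)^{-r²}, whose logarithmic
-- derivative gives
--   n A_n(r) = (2r + 1) A_{n-1}(r) + (n - 1 + 2r + 2r²) A_{n-2}(r).
-- Multiplying by (1 - t)^{n+1}, with r acting as t d/dt, turns this into the recurrence for I_n.
--
-- The reconstruction from the multiset is done one orbit at a time: in lexicographic order, the largest
-- orbit is the one of the last position, and removing it leaves a smaller coloured involution.
module Submission where

open import Defs
open import Data.Bool using (Bool; true; false; T; not; _∧_; _∨_; if_then_else_)
open import Data.Bool.ListAction using (any)
open import Data.Bool.Properties using (∧-zeroʳ)
open import Data.Empty using (⊥-elim)
open import Data.Integer as ℤ using (ℤ; +_; -[1+_]; ∣_∣; +≤+; -≤+; -≤-)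
import Data.Integer.Properties as ℤₚ
open import Data.Integer.Tactic.RingSolver using (solve-∀)
open import Data.List using (List; []; _∷_; _++_; map; length; takeWhile; dropWhile; initLast; _∷ʳ′_; concatMap; filterᵇ; upTo; drop)
open import Data.List.Membership.Propositional using (_∈_; _∉_; find; lose)
open import Data.List.Membership.Propositional.Properties using (∈-++⁺ˡ; ∈-++⁺ʳ; ∈-++⁻; ∈-map⁺; ∈-map⁻; ∈-concatMap⁺; ∈-concatMap⁻; ∈-filter⁺; ∈-filter⁻; ∈-upTo⁺; ∈-upTo⁻)
open import Data.List.Membership.Propositional.Properties.WithK using (unique∧set⇒bag)
open import Data.List.Properties using (length-++; length-map; map-++; map-∘; map-injective; ∷-injective; ∷-injectiveˡ; ∷-injectiveʳ; ∷ʳ-injective; takeWhile++dropWhile; concatMap-map; map-concatMap; concatMap-cong)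
open import Data.List.Relation.Binary.BagAndSetEquality using (∼bag⇒↭)
open import Data.List.Relation.Binary.Permutation.Propositional.Properties using (↭-length)
open import Data.List.Relation.Unary.All as All using ([]; _∷_)
open import Data.List.Relation.Unary.All.Properties using (all⁺; all⁻)
open import Data.List.Relation.Unary.AllPairs using ([]; _∷_)
open import Data.List.Relation.Unary.Any using (here; there)
open import Data.List.Relation.Unary.Unique.Propositional using (Unique)
import Data.List.Relation.Unary.Unique.Propositional.Properties as Uniqueₚ
open import Data.Nat as ℕ using (ℕ; zero; suc; _≤_; _<_; z≤n; s≤s)
open import Data.Product using (∃; ∃₂; _×_; _,_; proj₁; proj₂)
open import Data.Sign.Base using (Sign) renaming (+ to ⊕; - to ⊖)
open import Data.Sum using (_⊎_; inj₁; inj₂)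
open import Data.Unit using (tt)
open import Function.Base using (_∘_)
open import Function.Bundles using (mk⇔)
open import Relation.Binary.PropositionalEquality
open import Relation.Nullary using (¬_; yes; no; Dec; ofʸ; ofⁿ)
open import Relation.Nullary.Decidable using (⌊_⌋; toWitness; fromWitness; T?)

-- Neither a product of series nor a bijection with multisets is formed. When a new largest letter
-- `ℓ` joins an alphabet `S`, a word over `ℓ ∷ S` either avoids `ℓ` or arises from a shorter word by
-- inserting the orbit of `ℓ` at the end. The duplicate-free list for `ℓ ∷ S` is therefore built
-- recursively from the list for `S`, and its generating function gains a factor 1/(1 - u) or 1/(1 -
-- u²). The obstacle is the orbit of (r , -r). It covers one position, but in a block of colour r
-- the order reverses the positions carrying it: two copies of it make a 2-cycle, and only an odd
-- copy left over in the middle is a fixed -i. Its factor appears as (1 + u)/(1 - u²), and the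
-- argument wants every other letter present to have a smaller colour. This dictates the order in
-- which the alphabet is filled. The series in u is known only through the recurrence that its
-- differential equation gives for the coefficients. In t, division by 1 - t is the prefix sum;
-- prefix sums are injective, which is how powers of 1 - t are cancelled.

-- Positions in words and the insertion of a 2-cycle.

module Positions where

  open import Data.Nat using (_+_)
  open import Data.Nat.Properties

  private
    variable
      A B : Set
      x y : A
      xs ys : List A
      i j k m n : ℕ

  data At {A : Set} : List A → ℕ → A → Set where
    here  : At (x ∷ xs) zero x
    there : At xs i x → At (y ∷ xs) (suc i) x

  At-functional : At xs i x → At xs i y → x ≡ y
  At-functional here      here      = refl
  At-functional (there p) (there q) = At-functional p q

  At-< : At xs i x → i < length xs
  At-< here      = s≤s z≤n
  At-< (there p) = s≤s (At-< p)

  At-total : (xs : List A) → i < length xs → ∃ (At xs i)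
  At-total {i = zero}  (x ∷ xs) _       = x , here
  At-total {i = suc i} (x ∷ xs) (s≤s p) with At-total xs p
  ... | y , q = y , there q

  At-++ˡ : At xs i x → At (xs ++ ys) i x
  At-++ˡ here      = here
  At-++ˡ (there p) = there (At-++ˡ p)

  At-++ʳ : (xs : List A) → At ys i x → At (xs ++ ys) (length xs + i) x
  At-++ʳ []       p = p
  At-++ʳ (_ ∷ xs) p = there (At-++ʳ xs p)

  At-length : (xs : List A) → At (xs ++ y ∷ ys) (length xs) y
  At-length []       = here
  At-length (_ ∷ xs) = there (At-length xs)

  At-snoc⁻ : (xs : List A) → At (xs ++ y ∷ []) i x → (i ≡ length xs × x ≡ y) ⊎ At xs i x
  At-snoc⁻ []       here      = inj₁ (refl , refl)
  At-snoc⁻ (_ ∷ xs) here      = inj₂ here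
  At-snoc⁻ (_ ∷ xs) (there p) with At-snoc⁻ xs p
  ... | inj₁ (refl , refl) = inj₁ (refl , refl)
  ... | inj₂ q             = inj₂ (there q)

  At-map : (f : A → B) → At xs i x → At (map f xs) i (f x)
  At-map f here      = here
  At-map f (there p) = there (At-map f p)

  At-map⁻ : (f : A → B) (xs : List A) → At (map f xs) i y → ∃ λ x → y ≡ f x × At xs i x
  At-map⁻ f (x ∷ xs) here      = x , refl , here
  At-map⁻ f (x ∷ xs) (there p) with At-map⁻ f xs p
  ... | x′ , eq , q = x′ , eq , there q

  At-split : At xs i x → ∃₂ λ ys zs → xs ≡ ys ++ x ∷ zs × length ys ≡ i
  At-split {xs = x ∷ xs} here      = [] , xs , refl , refl
  At-split {xs = x ∷ xs} (there p) with At-split p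
  ... | ys , zs , refl , refl = x ∷ ys , zs , refl , refl

  -- The simplicial coface map: the increasing injection of ℕ that misses exactly `j`. It renumbers
  -- positions and indices when a new position `j` opens up.
  skip : ℕ → ℕ → ℕ
  skip zero    m       = suc m
  skip (suc j) zero    = zero
  skip (suc j) (suc m) = suc (skip j m)

  skip-≢ : ∀ j m → ¬ skip j m ≡ j
  skip-≢ zero    m       ()
  skip-≢ (suc j) zero    ()
  skip-≢ (suc j) (suc m) eq = skip-≢ j m (suc-injective eq)

  skip-injective : ∀ j {m n} → skip j m ≡ skip j n → m ≡ n
  skip-injective zero    refl = refl
  skip-injective (suc j) {zero}  {zero}  eq = refl
  skip-injective (suc j) {suc m} {suc n} eq = cong suc (skip-injective j (suc-injective eq))

  skip-mono-≤ : ∀ j {m n} → m ≤ n → skip j m ≤ skip j n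
  skip-mono-≤ zero    m≤n       = s≤s m≤n
  skip-mono-≤ (suc j) z≤n       = z≤n
  skip-mono-≤ (suc j) (s≤s m≤n) = s≤s (skip-mono-≤ j m≤n)

  skip-cancel-≤ : ∀ j {m n} → skip j m ≤ skip j n → m ≤ n
  skip-cancel-≤ zero    (s≤s p)                 = p
  skip-cancel-≤ (suc j) {zero}  {n}     p       = z≤n
  skip-cancel-≤ (suc j) {suc m} {suc n} (s≤s p) = s≤s (skip-cancel-≤ j p)

  skip-surjective : ∀ j {m} → ¬ m ≡ j → ∃ λ m′ → m ≡ skip j m′
  skip-surjective zero    {zero}  m≢j = ⊥-elim (m≢j refl)
  skip-surjective zero    {suc m} m≢j = m , refl
  skip-surjective (suc j) {zero}  m≢j = zero , refl
  skip-surjective (suc j) {suc m} m≢j with skip-surjective j (λ eq → m≢j (cong suc eq))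
  ... | m′ , eq = suc m′ , cong suc eq

  skip-≤ : ∀ j m → skip j m ≤ suc m
  skip-≤ zero    m       = ≤-refl
  skip-≤ (suc j) zero    = z≤n
  skip-≤ (suc j) (suc m) = s≤s (skip-≤ j m)

  skip-< : ∀ {j m} → m < j → skip j m < j
  skip-< {suc j} {zero}  _         = s≤s z≤n
  skip-< {suc j} {suc m} (s≤s m<j) = s≤s (skip-< m<j)

  skip-> : ∀ {j m} → j ≤ m → j < skip j m
  skip-> {zero}          _         = s≤s z≤n
  skip-> {suc j} {suc m} (s≤s j≤m) = s≤s (skip-> j≤m)

  At-skip : (xs : List A) → At (xs ++ ys) i x → At (xs ++ y ∷ ys) (skip (length xs) i) x
  At-skip []       p         = there p
  At-skip (_ ∷ xs) here      = here
  At-skip (_ ∷ xs) (there p) = there (At-skip xs p)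

  At-skip⁻ : (xs : List A) → At (xs ++ y ∷ ys) i x →
             (i ≡ length xs × x ≡ y) ⊎ ∃ λ i′ → i ≡ skip (length xs) i′ × At (xs ++ ys) i′ x
  At-skip⁻ []       here      = inj₁ (refl , refl)
  At-skip⁻ []       (there p) = inj₂ (_ , refl , p)
  At-skip⁻ (_ ∷ xs) here      = inj₂ (zero , refl , here)
  At-skip⁻ (_ ∷ xs) (there p) with At-skip⁻ xs p
  ... | inj₁ (refl , refl)   = inj₁ (refl , refl)
  ... | inj₂ (i′ , refl , q) = inj₂ (suc i′ , refl , there q)

  -- An entry (a , s , m) at position i stands for πᵢ = s m, with colour a; positions and indices
  -- are 0-based, so the entry of ℤ is s (m + 1).
  Entry : Set
  Entry = ℕ × Sign × ℕ

  colour : Entry → ℕ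
  colour = proj₁

  relabel : ℕ → Entry → Entry
  relabel j (a , s , m) = a , s , skip j m

  -- For a signed involution `π i = s m` forces `π m = s i`, with the same sign. The existence of
  -- the entry at `m` also keeps every index within range; the colour `c` there is free.
  Involutive : List Entry → Set
  Involutive q = ∀ {i a s m} → At q i (a , s , m) → ∃ λ c → At q m (c , s , i)

  -- Insert a 2-cycle joining a new position between xs and ys to a new last position.
  double : List Entry → List Entry → Entry → List Entry
  double xs ys (r , s , c) =
    (map (relabel (length xs)) xs ++ (c , s , suc (length (xs ++ ys))) ∷ map (relabel (length xs)) ys)
    ++ (r , s , length xs) ∷ []

  module _ (xs ys : List Entry) {r : ℕ} {s : Sign} {c : ℕ} where

    private
      n₀ = length (xs ++ ys)
      j₀ = length xs
      f  = relabel j₀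
      D  = double xs ys (r , s , c)
      Q  = map f xs ++ (c , s , suc n₀) ∷ map f ys

      length-init : length Q ≡ suc n₀
      length-init = begin
        length Q                                 ≡⟨ length-++ (map f xs) ⟩
        length (map f xs) + suc (length (map f ys))
          ≡⟨ cong₂ (λ a b → a + suc b) (length-map f xs) (length-map f ys) ⟩
        j₀ + suc (length ys)                     ≡⟨ +-suc j₀ (length ys) ⟩
        suc (j₀ + length ys)                     ≡⟨ cong suc (length-++ xs) ⟨
        suc n₀                                   ∎
        where open ≡-Reasoning

    length-double : length D ≡ suc (suc n₀)
    length-double = begin
      length D                         ≡⟨ length-++ Q ⟩
      length Q + 1                     ≡⟨ +-comm (length Q) 1 ⟩
      suc (length Q)                   ≡⟨ cong suc length-init ⟩
      suc (suc n₀)                     ∎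
      where open ≡-Reasoning

    At-double-old : ∀ {i a t m} → At (xs ++ ys) i (a , t , m) →
                    At D (skip j₀ i) (a , t , skip j₀ m)
    At-double-old {i} {a} {t} {m} p = At-++ˡ (subst (λ l → At Q (skip l i) (a , t , skip j₀ m)) (length-map f xs)
      (At-skip (map f xs) (subst (λ l → At l i (a , t , skip j₀ m)) (map-++ f xs ys) (At-map f p))))

    At-double-mid : At D j₀ (c , s , suc n₀)
    At-double-mid = At-++ˡ (subst (λ l → At Q l (c , s , suc n₀)) (length-map f xs) (At-length (map f xs)))

    At-double-last : At D (suc n₀) (r , s , j₀)
    At-double-last = subst (λ l → At D l (r , s , j₀)) length-init (At-length Q)

    data DoubleView (i : ℕ) : Entry → Set where
      old  : ∀ {i′ a t m} → i ≡ skip j₀ i′ → At (xs ++ ys) i′ (a , t , m) →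
             DoubleView i (a , t , skip j₀ m)
      mid  : i ≡ j₀ → DoubleView i (c , s , suc n₀)
      last : i ≡ suc n₀ → DoubleView i (r , s , j₀)

    At-double⁻ : ∀ {i e} → At D i e → DoubleView i e
    At-double⁻ p with At-snoc⁻ Q p
    ... | inj₁ (eq , refl) = last (trans eq length-init)
    ... | inj₂ q with At-skip⁻ (map f xs) q
    ...   | inj₁ (eq , refl) = mid (trans eq (length-map f xs))
    ...   | inj₂ (i′ , eq , u)
      with At-map⁻ f (xs ++ ys) (subst (λ l → At l i′ _) (sym (map-++ f xs ys)) u)
    ...     | (a , t , m) , refl , v = old (trans eq (cong (λ l → skip l i′) (length-map f xs))) v

    involutive-double : Involutive (xs ++ ys) → Involutive D
    involutive-double inv p with At-double⁻ p
    ... | old refl q with inv q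
    ...   | c′ , q′ = c′ , At-double-old q′
    involutive-double inv p | mid refl  = r , At-double-last
    involutive-double inv p | last refl = c , At-double-mid

    involutive-double⁻ : Involutive D → Involutive (xs ++ ys)
    involutive-double⁻ inv {i} {a} {t} {m} p with inv (At-double-old p)
    ... | c′ , q = go refl refl (At-double⁻ q)
      where
      go : ∀ {k e} → k ≡ skip j₀ m → e ≡ (c′ , t , skip j₀ i) → DoubleView k e →
           ∃ λ c → At (xs ++ ys) m (c , t , i)
      -- The partner of an old entry is old: `skip j₀` never takes the value `j₀`, which is the
      -- position of `mid` and the index stored in `last`.
      go eq₁ eq₂ (mid eq) = ⊥-elim (skip-≢ j₀ m (trans (sym eq₁) eq))
      go eq₁ eq₂ (last eq) = ⊥-elim (skip-≢ j₀ i (sym (cong (λ e → proj₂ (proj₂ e)) eq₂)))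
      go eq₁ eq₂ (old {i′} {a′} {t′} {m′} eq u)
        with skip-injective j₀ (trans (sym eq) eq₁)
           | skip-injective j₀ (cong (λ e → proj₂ (proj₂ e)) eq₂) | cong (λ e → proj₁ (proj₂ e)) eq₂
      ... | refl | refl | refl = a′ , u

-- Coloured involutions as sorted words over an alphabet of orbits.

module ColouredWords where

  open Positions
  open import Data.Nat using (_+_)
  open import Data.Nat.Properties

  infix 4 _≼_ _⊑_

  -- The order of ℤ on signed magnitudes. It compares the values in a word and also the signed
  -- colours in a letter.
  data _≼_ : Sign × ℕ → Sign × ℕ → Set where
    ⊖≼⊖ : ∀ {m n} → n ≤ m → (⊖ , m) ≼ (⊖ , n)
    ⊖≼⊕ : ∀ {m n} → (⊖ , m) ≼ (⊕ , n)
    ⊕≼⊕ : ∀ {m n} → m ≤ n → (⊕ , m) ≼ (⊕ , n)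

  -- For consecutive entries this lexicographic order is the colouring condition in one piece: the
  -- colour weakly increases, and strictly where the value drops.
  data _⊑_ : Entry → Entry → Set where
    colour< : ∀ {a b v w} → a < b → (a , v) ⊑ (b , w)
    value≼  : ∀ {a v w} → v ≼ w → (a , v) ⊑ (a , w)

  ≼-refl : ∀ {v} → v ≼ v
  ≼-refl {⊖ , m} = ⊖≼⊖ ≤-refl
  ≼-refl {⊕ , m} = ⊕≼⊕ ≤-refl

  ≼-trans : ∀ {u v w} → u ≼ v → v ≼ w → u ≼ w
  ≼-trans (⊖≼⊖ p) (⊖≼⊖ q) = ⊖≼⊖ (≤-trans q p)
  ≼-trans (⊖≼⊖ p) ⊖≼⊕     = ⊖≼⊕
  ≼-trans ⊖≼⊕     (⊕≼⊕ q) = ⊖≼⊕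
  ≼-trans (⊕≼⊕ p) (⊕≼⊕ q) = ⊕≼⊕ (≤-trans p q)

  ≼-antisym : ∀ {v w} → v ≼ w → w ≼ v → v ≡ w
  ≼-antisym (⊖≼⊖ p) (⊖≼⊖ q) = cong (⊖ ,_) (≤-antisym q p)
  ≼-antisym (⊕≼⊕ p) (⊕≼⊕ q) = cong (⊕ ,_) (≤-antisym p q)

  ⊑-refl : ∀ {e} → e ⊑ e
  ⊑-refl = value≼ ≼-refl

  ⊑-trans : ∀ {d e f} → d ⊑ e → e ⊑ f → d ⊑ f
  ⊑-trans (colour< p) (colour< q) = colour< (<-trans p q)
  ⊑-trans (colour< p) (value≼ q)  = colour< p
  ⊑-trans (value≼ p)  (colour< q) = colour< q
  ⊑-trans (value≼ p)  (value≼ q)  = value≼ (≼-trans p q)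

  ⊑-antisym : ∀ {d e} → d ⊑ e → e ⊑ d → d ≡ e
  ⊑-antisym (colour< p) (colour< q) = ⊥-elim (<-asym p q)
  ⊑-antisym (colour< p) (value≼ q)  = ⊥-elim (<-irrefl refl p)
  ⊑-antisym (value≼ p)  (colour< q) = ⊥-elim (<-irrefl refl q)
  ⊑-antisym (value≼ p)  (value≼ q)  = cong (_ ,_) (≼-antisym p q)

  ⊑⇒colour≤ : ∀ {d e} → d ⊑ e → colour d ≤ colour e
  ⊑⇒colour≤ (colour< p) = <⇒≤ p
  ⊑⇒colour≤ (value≼ p)  = ≤-refl

  relabel-mono : ∀ j {d e} → d ⊑ e → relabel j d ⊑ relabel j e
  relabel-mono j (colour< p)        = colour< p
  relabel-mono j (value≼ (⊖≼⊖ p))   = value≼ (⊖≼⊖ (skip-mono-≤ j p))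
  relabel-mono j (value≼ ⊖≼⊕)       = value≼ ⊖≼⊕
  relabel-mono j (value≼ (⊕≼⊕ p))   = value≼ (⊕≼⊕ (skip-mono-≤ j p))

  relabel-cancel : ∀ j {a s m b t n} → (a , s , skip j m) ⊑ (b , t , skip j n) → (a , s , m) ⊑ (b , t , n)
  relabel-cancel j (colour< p)      = colour< p
  relabel-cancel j (value≼ (⊖≼⊖ p)) = value≼ (⊖≼⊖ (skip-cancel-≤ j p))
  relabel-cancel j (value≼ ⊖≼⊕)     = value≼ ⊖≼⊕
  relabel-cancel j (value≼ (⊕≼⊕ p)) = value≼ (⊕≼⊕ (skip-cancel-≤ j p))

  Sorted : List Entry → Set
  Sorted q = ∀ {i j d e} → i < j → At q i d → At q j e → d ⊑ e

  -- π₀ = 0 with colour 0; comparing with the value 1 instead of 0 makes no difference.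
  bottom : Entry
  bottom = 0 , ⊕ , 0

  -- The letter of an entry (a , s , m) is (a , s , c) with c the colour of position m.  A 2-cycle
  -- contributes two letters, of which only the one with c ≤ a is constrained.
  Allowed : List Entry → List Entry → Set
  Allowed S q = ∀ {i a s m c v} → At q i (a , s , m) → At q m (c , v) → c ≤ a → (a , s , c) ∈ S

  record Valid (S : List Entry) (n : ℕ) (q : List Entry) : Set where
    constructor mkValid
    field
      length≡    : length q ≡ n
      sorted     : Sorted q
      positive   : ∀ {i e} → At q i e → bottom ⊑ e
      involutive : Involutive q
      allowed    : Allowed S q

  open Valid

  index-< : ∀ {q i a s m} → Involutive q → At q i (a , s , m) → m < length q
  index-< inv p = At-< (proj₂ (inv p))

  colour-mono : ∀ {q i j d e} → Sorted q → i ≤ j → At q i d → At q j e → colour d ≤ colour e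
  colour-mono {i = i} {j} so i≤j p p′ with m≤n⇒m<n∨m≡n i≤j
  ... | inj₁ i<j  = ⊑⇒colour≤ (so i<j p p′)
  ... | inj₂ refl with At-functional p p′
  ...   | refl = ≤-refl

  -- Colours weakly increase along the word, so replacing an index by the colour of the position it
  -- names preserves the order. Hence the last entry, the largest, has the largest letter.
  letter-mono : ∀ {q a s m b t n c d v w} → Sorted q → (a , s , m) ⊑ (b , t , n) →
                At q m (c , v) → At q n (d , w) → (a , s , c) ⊑ (b , t , d)
  letter-mono so (colour< p)      u u′ = colour< p
  letter-mono so (value≼ (⊖≼⊖ p)) u u′ = value≼ (⊖≼⊖ (colour-mono so p u′ u))
  letter-mono so (value≼ ⊖≼⊕)     u u′ = value≼ ⊖≼⊕
  letter-mono so (value≼ (⊕≼⊕ p)) u u′ = value≼ (⊕≼⊕ (colour-mono so p u u′))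

  -- Within a cycle the letter is constrained at the end of larger colour; the other end is bounded
  -- through its partner.
  colour-≤ : ∀ {S n q r} → (∀ {e} → e ∈ S → colour e ≤ r) → Valid S n q →
             ∀ {i e} → At q i e → colour e ≤ r
  colour-≤ {q = q} {r} bound V {i} {a , s , m} p with involutive V p
  ... | c , p′ with ≤-total c a
  ...   | inj₁ c≤a = bound (allowed V p p′ c≤a)
  ...   | inj₂ a≤c = ≤-trans a≤c (bound (allowed V p′ p a≤c))

  weaken : ∀ {S n q ℓ} → Valid S n q → Valid (ℓ ∷ S) n q
  weaken (mkValid l so po inv al) = mkValid l so po inv (λ p p′ c≤a → there (al p p′ c≤a))

  -- The position at which the partner of the last entry is inserted is the number of colours below
  -- this threshold.
  threshold : Sign → ℕ → ℕ
  threshold ⊕ c = suc c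
  threshold ⊖ c = c

  -- The letters of a 2-cycle, read at its last position. Sign `⊕` excludes `c = r`, since the cycle
  -- would be a descent inside one colour. Sign `⊖` excludes `c = 0`, since colour 0 carries only
  -- positive values, but it allows `c = r`, where both ends carry the same letter.
  data PairLetter : Entry → Set where
    ⊕-pair : ∀ {r c} → c < r → PairLetter (r , ⊕ , c)
    ⊖-pair : ∀ {r c} → 0 < c → c ≤ r → PairLetter (r , ⊖ , c)

  record Cut (t : ℕ) (xs ys : List Entry) : Set where
    constructor mkCut
    field
      below : ∀ {i e} → At (xs ++ ys) i e → i < length xs → colour e < t
      above : ∀ {i e} → At (xs ++ ys) i e → length xs ≤ i → t ≤ colour e

    below⁻ : ∀ {i e} → At (xs ++ ys) i e → colour e < t → i < length xs
    below⁻ {i} p c<t with <-≤-connex i (length xs)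
    ... | inj₁ i<l = i<l
    ... | inj₂ l≤i = ⊥-elim (<⇒≱ c<t (above p l≤i))

    above⁻ : ∀ {i e} → At (xs ++ ys) i e → t ≤ colour e → length xs ≤ i
    above⁻ {i} p t≤c with <-≤-connex i (length xs)
    ... | inj₁ i<l = ⊥-elim (<⇒≱ (below p i<l) t≤c)
    ... | inj₂ l≤i = l≤i

  Top : Entry → List Entry → Set
  Top ℓ S = ∀ {e} → e ∈ S → e ⊑ ℓ

  top-∷ : ∀ {ℓ S} → Top ℓ S → Top ℓ (ℓ ∷ S)
  top-∷ top (here refl) = ⊑-refl
  top-∷ top (there p)   = top p

  length-≤-++ : (xs ys : List Entry) → length xs ≤ length (xs ++ ys)
  length-≤-++ xs ys = subst (length xs ≤_) (sym (length-++ xs)) (m≤m+n _ _)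

  module _ {S : List Entry} {r : ℕ} {s : Sign} {c : ℕ} (pl : PairLetter (r , s , c))
           (top : Top (r , s , c) S) (xs ys : List Entry) (cut : Cut (threshold s c) xs ys)
           (V : Valid ((r , s , c) ∷ S) (length (xs ++ ys)) (xs ++ ys)) where

    private
      n₀ = length (xs ++ ys)
      j₀ = length xs
      D  = double xs ys (r , s , c)

      bounded : ∀ {i e} → At (xs ++ ys) i e → colour e ≤ r
      bounded = colour-≤ (λ e∈ → ⊑⇒colour≤ (top-∷ top e∈)) V

      index-≤ : ∀ {i a t m} → At (xs ++ ys) i (a , t , m) → skip j₀ m ≤ suc n₀
      index-≤ {m = m} p = ≤-trans (skip-≤ j₀ m) (s≤s (<⇒≤ (index-< (involutive V) p)))

      -- The inserted partner has the largest index. With sign `⊕` it is the largest value of colour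
      -- `c` and must follow that block; with sign `⊖` it is the smallest and must precede it. Hence
      -- the thresholds `suc c` and `c`.
      old⊑mid : PairLetter (r , s , c) → ∀ {i a t m} → At (xs ++ ys) i (a , t , m) → a < threshold s c →
                (a , t , skip j₀ m) ⊑ (c , s , suc n₀)
      old⊑mid (⊕-pair _) {t = t} p (s≤s a≤c) with m≤n⇒m<n∨m≡n a≤c
      ... | inj₁ a<c = colour< a<c
      old⊑mid (⊕-pair _) {t = ⊖} p (s≤s a≤c) | inj₂ refl = value≼ ⊖≼⊕
      old⊑mid (⊕-pair _) {t = ⊕} p (s≤s a≤c) | inj₂ refl = value≼ (⊕≼⊕ (index-≤ p))
      old⊑mid (⊖-pair _ _) p a<c = colour< a<c

      mid⊑old : PairLetter (r , s , c) → ∀ {i a t m} → At (xs ++ ys) i (a , t , m) → threshold s c ≤ a →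
                (c , s , suc n₀) ⊑ (a , t , skip j₀ m)
      mid⊑old (⊕-pair _) p c<a = colour< c<a
      mid⊑old (⊖-pair _ _) {t = t} p c≤a with m≤n⇒m<n∨m≡n c≤a
      ... | inj₁ c<a = colour< c<a
      mid⊑old (⊖-pair _ _) {t = ⊕} p c≤a | inj₂ refl = value≼ ⊖≼⊕
      mid⊑old (⊖-pair _ _) {t = ⊖} p c≤a | inj₂ refl = value≼ (⊖≼⊖ (index-≤ p))

      mid⊑last : PairLetter (r , s , c) → (c , s , suc n₀) ⊑ (r , s , j₀)
      mid⊑last (⊕-pair c<r) = colour< c<r
      mid⊑last (⊖-pair _ c≤r) with m≤n⇒m<n∨m≡n c≤r
      ... | inj₁ c<r  = colour< c<r
      ... | inj₂ refl = value≼ (⊖≼⊖ (m≤n⇒m≤1+n (length-≤-++ xs ys)))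

      -- A converse of `letter-mono` for the inserted letter: the cut separates positions by colour,
      -- so comparing a partner's colour with `c` puts its position on a known side of `j₀`.
      index≼ : ∀ {t m c′ w} → At (xs ++ ys) m (c′ , w) → (t , c′) ≼ (s , c) → Cut (threshold s c) xs ys →
               (t , skip j₀ m) ≼ (s , j₀)
      index≼ p ⊖≼⊕        cut = ⊖≼⊕
      index≼ p (⊖≼⊖ c≤c′) cut = ⊖≼⊖ (<⇒≤ (skip-> (Cut.above⁻ cut p c≤c′)))
      index≼ p (⊕≼⊕ c′≤c) cut = ⊕≼⊕ (<⇒≤ (skip-< (Cut.below⁻ cut p (s≤s c′≤c))))

      -- If the colours tie at `r`, the partner of the old entry has colour at most `r`, so the
      -- letter of the old entry is in the alphabet and hence at most the top letter.
      old⊑last : ∀ {i a t m} → At (xs ++ ys) i (a , t , m) → (a , t , skip j₀ m) ⊑ (r , s , j₀)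
      old⊑last {a = a} p with m≤n⇒m<n∨m≡n (bounded p)
      ... | inj₁ a<r  = colour< a<r
      ... | inj₂ refl with involutive V p
      ...   | c′ , p′ with top-∷ top (allowed V p p′ (bounded p′))
      ...     | colour< r<r = ⊥-elim (<-irrefl refl r<r)
      ...     | value≼ v≼w  = value≼ (index≼ p′ v≼w cut)

      sortedD : Sorted D
      sortedD i<j p q with At-double⁻ xs ys p | At-double⁻ xs ys q
      ... | old refl u | old {i′ = j} refl v =
            relabel-mono j₀ (sorted V (≰⇒> (λ j≤i → <⇒≱ i<j (skip-mono-≤ j₀ j≤i))) u v)
      ... | old {i′ = i} refl u | mid refl  =
            old⊑mid pl u (Cut.below cut u (≰⇒> (λ j≤i → <-asym i<j (skip-> j≤i))))
      ... | old eq u   | last eq′ = old⊑last u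
      ... | mid refl   | old refl v =
            mid⊑old pl v (Cut.above cut v (≮⇒≥ (λ i<j₀ → <-asym i<j (skip-< i<j₀))))
      ... | mid refl   | mid refl  = ⊥-elim (<-irrefl refl i<j)
      ... | mid eq     | last eq′ = mid⊑last pl
      ... | last refl  | old {i′ = j} refl v =
            ⊥-elim (<⇒≱ i<j (≤-trans (skip-≤ j₀ j) (s≤s (<⇒≤ (At-< v)))))
      ... | last refl  | mid refl  = ⊥-elim (<⇒≱ i<j (m≤n⇒m≤1+n (length-≤-++ xs ys)))
      ... | last refl  | last refl = ⊥-elim (<-irrefl refl i<j)

      mid-positive : PairLetter (r , s , c) → bottom ⊑ (c , s , suc n₀)
      mid-positive (⊖-pair 0<c _) = colour< 0<c
      mid-positive (⊕-pair _) with m≤n⇒m<n∨m≡n (z≤n {c})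
      ... | inj₁ 0<c  = colour< 0<c
      ... | inj₂ refl = value≼ (⊕≼⊕ z≤n)

      positiveD : ∀ {i e} → At D i e → bottom ⊑ e
      positiveD p with At-double⁻ xs ys p
      ... | old _ u with positive V u
      ...   | colour< 0<a       = colour< 0<a
      ...   | value≼ (⊕≼⊕ _)    = value≼ (⊕≼⊕ z≤n)
      positiveD p | mid _  = mid-positive pl
      positiveD p | last _ = ⊑-trans (mid-positive pl) (mid⊑last pl)

      mid-letter : PairLetter (r , s , c) → r ≤ c → (c , s , r) ∈ (r , s , c) ∷ S
      mid-letter (⊕-pair c<r) r≤c = ⊥-elim (<⇒≱ c<r r≤c)
      mid-letter (⊖-pair _ c≤r) r≤c with ≤-antisym c≤r r≤c
      ... | refl = here refl

      allowedD : Allowed ((r , s , c) ∷ S) D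
      allowedD p p′ c≤a with At-double⁻ xs ys p
      ... | old {m = m} refl u with involutive V u
      ...   | c″ , u′ with At-functional p′ (At-double-old xs ys u′)
      ...     | refl = allowed V u u′ c≤a
      allowedD p p′ c≤a | mid refl with At-functional p′ (At-double-last xs ys)
      ... | refl = mid-letter pl c≤a
      allowedD p p′ c≤a | last refl with At-functional p′ (At-double-mid xs ys)
      ... | refl = here refl

    double-valid : Valid ((r , s , c) ∷ S) (suc (suc n₀)) D
    double-valid = mkValid (length-double xs ys) sortedD positiveD
      (involutive-double xs ys (involutive V)) allowedD

  module _ {S : List Entry} {xs ys : List Entry} {r : ℕ} {s : Sign} {c N : ℕ}
           (V : Valid S N (double xs ys (r , s , c))) where

    private
      n₀ = length (xs ++ ys)
      j₀ = length xs
      inv = involutive-double⁻ xs ys (involutive V)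

    double-valid⁻ : Valid S n₀ (xs ++ ys)
    double-valid⁻ = mkValid refl
      (λ i<j p q → relabel-cancel j₀ (sorted V (≰⇒> (λ j≤i → <⇒≱ i<j (skip-cancel-≤ j₀ j≤i)))
                     (At-double-old xs ys p) (At-double-old xs ys q)))
      (λ p → pos (positive V (At-double-old xs ys p)))
      inv
      (λ p p′ → allowed V (At-double-old xs ys p) (At-double-old xs ys p′))
      where
      pos : ∀ {a t m} → bottom ⊑ (a , t , skip j₀ m) → bottom ⊑ (a , t , m)
      pos (colour< 0<a)     = colour< 0<a
      pos (value≼ (⊕≼⊕ _)) = value≼ (⊕≼⊕ z≤n)

    -- The partner precedes the last entry although its index `suc n₀` exceeds `j₀`, so positive
    -- sign forces a strict increase of colour. A negative partner lies above `bottom` only if its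
    -- colour is positive.
    double-pairLetter : PairLetter (r , s , c)
    double-pairLetter = go s refl
      where
      go : ∀ t → t ≡ s → PairLetter (r , t , c)
      go t refl with sorted V (s≤s (length-≤-++ xs ys)) (At-double-mid xs ys) (At-double-last xs ys)
      go ⊕ refl | colour< c<r = ⊕-pair c<r
      go ⊕ refl | value≼ (⊕≼⊕ n<j) = ⊥-elim (<⇒≱ n<j (length-≤-++ xs ys))
      go ⊖ refl | p with positive V (At-double-mid xs ys)
      ... | colour< 0<c = ⊖-pair 0<c (⊑⇒colour≤ p)

    -- Sortedness leaves no choice of insertion point: relabelled old indices are at most `n₀`, so
    -- the partner of index `suc n₀` is extreme among the entries of its colour and sign.
    double-cut : Cut (threshold s c) xs ys
    double-cut = mkCut below above
      where
      index-≤ : ∀ {i a t m} → At (xs ++ ys) i (a , t , m) → skip j₀ m ≤ n₀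
      index-≤ {m = m} p = ≤-trans (skip-≤ j₀ m) (index-< inv p)

      lower : ∀ t {d m k} → skip j₀ m ≤ n₀ → (d , k , skip j₀ m) ⊑ (c , t , suc n₀) → d < threshold t c
      lower ⊕ le d                      = s≤s (⊑⇒colour≤ d)
      lower ⊖ le (colour< d<c)          = d<c
      lower ⊖ le (value≼ (⊖≼⊖ n<m))     = ⊥-elim (<⇒≱ n<m le)

      upper : ∀ t {d m k} → skip j₀ m ≤ n₀ → (c , t , suc n₀) ⊑ (d , k , skip j₀ m) → threshold t c ≤ d
      upper ⊖ le d                      = ⊑⇒colour≤ d
      upper ⊕ le (colour< c<d)          = c<d
      upper ⊕ le (value≼ (⊕≼⊕ n<m))     = ⊥-elim (<⇒≱ n<m le)

      below : ∀ {i e} → At (xs ++ ys) i e → i < j₀ → colour e < threshold s c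
      below p i<j = lower s (index-≤ p) (sorted V (skip-< i<j) (At-double-old xs ys p) (At-double-mid xs ys))

      above : ∀ {i e} → At (xs ++ ys) i e → j₀ ≤ i → threshold s c ≤ colour e
      above p j≤i = upper s (index-≤ p) (sorted V (skip-> j≤i) (At-double-mid xs ys) (At-double-old xs ys p))

  unrelabel : ∀ j (zs : List Entry) → (∀ {i a s m} → At zs i (a , s , m) → ¬ m ≡ j) →
              ∃ λ xs → zs ≡ map (relabel j) xs
  unrelabel j []                 h = [] , refl
  unrelabel j ((a , s , m) ∷ zs) h with skip-surjective j (h here) | unrelabel j zs (λ p → h (there p))
  ... | m′ , refl | xs , refl = (a , s , m′) ∷ xs , refl

  pairView : ∀ {Q a s m c N} → length Q ≡ N → Involutive (Q ++ (a , s , m) ∷ []) → At Q m (c , s , N) →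
             ∃₂ λ xs ys → Q ++ (a , s , m) ∷ [] ≡ double xs ys (a , s , c)
  pairView {Q} {a} {s} {m} {c} {N} len inv p with At-split p
  ... | zs , ws , refl , refl
    with unrelabel m zs (λ q → avoid (At-++ˡ q)) | unrelabel m ws (λ q → avoid (At-++ʳ zs (there q)))
    where
    -- Position `m` already points to `N`, so an entry of index `m` could only stand at `N`, beyond
    -- `Q`.
    avoid : ∀ {i b t k} → At Q i (b , t , k) → ¬ k ≡ m
    avoid q refl with inv (At-++ˡ q)
    ... | _ , q′ with At-functional q′ (At-++ˡ p)
    ...   | refl = <-irrefl (sym len) (At-< q)
  ...   | xs , eq₁ | ys , eq₂ = xs , ys , eq
    where
    lenz : length zs ≡ length xs
    lenz = trans (cong length eq₁) (length-map _ xs)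

    lenQ : N ≡ suc (length (xs ++ ys))
    lenQ = begin
      N                               ≡⟨ len ⟨
      length (zs ++ _ ∷ ws)           ≡⟨ length-++ zs ⟩
      length zs + suc (length ws)     ≡⟨ cong₂ (λ i j → i + suc j) lenz (trans (cong length eq₂) (length-map _ ys)) ⟩
      length xs + suc (length ys)     ≡⟨ +-suc (length xs) (length ys) ⟩
      suc (length xs + length ys)     ≡⟨ cong suc (length-++ xs) ⟨
      suc (length (xs ++ ys))         ∎
      where open ≡-Reasoning

    eq : Q ++ (a , s , m) ∷ [] ≡ double xs ys (a , s , c)
    eq = cong₂ (λ P k → P ++ (a , s , k) ∷ [])
      (cong₂ (λ P R → P ++ R) (trans eq₁ (cong (λ k → map (relabel k) xs) lenz))
        (cong₂ _∷_ (cong (λ k → c , s , k) lenQ) (trans eq₂ (cong (λ k → map (relabel k) ys) lenz)))) lenz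

  lastView : ∀ {Q a s m} → Involutive (Q ++ (a , s , m) ∷ []) →
             (m ≡ length Q) ⊎
             ∃₂ λ xs ys → ∃ λ c → Q ++ (a , s , m) ∷ [] ≡ double xs ys (a , s , c)
  lastView {Q} inv with inv (At-length Q)
  ... | c , p with At-snoc⁻ Q p
  ...   | inj₁ (m≡ , _) = inj₁ m≡
  ...   | inj₂ p′ with pairView refl inv p′
  ...     | xs , ys , eq = inj₂ (xs , ys , c , eq)

  module _ {S : List Entry} {Q : List Entry} {a : ℕ} {s : Sign} {m : ℕ} where

    private
      q = Q ++ (a , s , m) ∷ []

    -- The letter of the last entry is the largest in the word. If `ℓ` occurred earlier, then `ℓ`
    -- would be at most the last letter, which is at most `ℓ`; the two would coincide and put `ℓ` in
    -- `S`.
    drop-top : ∀ {ℓ n c v} → Top ℓ S → ℓ ∉ S → Valid (ℓ ∷ S) n q → At q m (c , v) →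
               (a , s , c) ∈ S → Valid S n q
    drop-top {ℓ} {c = c} top ℓ∉S V pm last∈S =
      mkValid (length≡ V) (sorted V) (positive V) (involutive V) allowed′
      where
      allowed′ : Allowed S q
      allowed′ p p′ c≤a with allowed V p p′ c≤a
      ... | there ∈S  = ∈S
      ... | here refl with At-snoc⁻ Q p
      ...   | inj₂ u = ⊥-elim (ℓ∉S (subst (_∈ S) (⊑-antisym (top last∈S)
                (letter-mono (sorted V) (sorted V (At-< u) p (At-length Q)) p′ pm)) last∈S))
      ...   | inj₁ (refl , refl) with At-functional p′ pm
      ...     | refl = last∈S

  module _ {S : List Entry} {Q : List Entry} {r : ℕ} where

    private
      N = length Q

      involutive-snoc : ∀ {s} → Involutive Q → Involutive (Q ++ (r , s , N) ∷ [])
      involutive-snoc inv p with At-snoc⁻ Q p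
      ... | inj₁ (refl , refl) = r , At-length Q
      ... | inj₂ u with inv u
      ...   | c , u′ = c , At-++ˡ u′

      sorted-snoc : ∀ {e} → Sorted Q → (∀ {i d} → At Q i d → d ⊑ e) → Sorted (Q ++ e ∷ [])
      sorted-snoc so h i<j p q with At-snoc⁻ Q p | At-snoc⁻ Q q
      ... | inj₁ (refl , refl) | inj₁ (refl , refl) = ⊥-elim (<-irrefl refl i<j)
      ... | inj₁ (refl , refl) | inj₂ v             = ⊥-elim (<-asym i<j (At-< v))
      ... | inj₂ u             | inj₁ (refl , refl) = h u
      ... | inj₂ u             | inj₂ v             = so i<j u v

      positive-snoc : ∀ {e} → (∀ {i d} → At Q i d → bottom ⊑ d) → bottom ⊑ e →
                      ∀ {i d} → At (Q ++ e ∷ []) i d → bottom ⊑ d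
      positive-snoc h b p with At-snoc⁻ Q p
      ... | inj₁ (refl , refl) = b
      ... | inj₂ u             = h u

      allowed-snoc : ∀ {s} → (r , s , r) ∈ S → Involutive Q → Allowed S Q →
                     Allowed S (Q ++ (r , s , N) ∷ [])
      allowed-snoc ℓ∈S inv al p p′ c≤a with At-snoc⁻ Q p
      ... | inj₁ (refl , refl) with At-functional p′ (At-length Q)
      ...   | refl = ℓ∈S
      allowed-snoc ℓ∈S inv al p p′ c≤a | inj₂ u with inv u
      ... | c , u′ with At-functional p′ (At-++ˡ u′)
      ...   | refl = al u u′ c≤a

      snoc-length : ∀ {e} → length (Q ++ e ∷ []) ≡ suc N
      snoc-length = trans (length-++ Q) (+-comm N 1)

    snoc-valid : ∀ {s n} → (r , s , r) ∈ S → Valid S n Q → (∀ {i d} → At Q i d → d ⊑ (r , s , N)) → bottom ⊑ (r , s , N) →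
                 Valid S (suc n) (Q ++ (r , s , N) ∷ [])
    snoc-valid ℓ∈S V h b = mkValid (trans snoc-length (cong suc (length≡ V))) (sorted-snoc (sorted V) h)
      (positive-snoc (positive V) b) (involutive-snoc (involutive V)) (allowed-snoc ℓ∈S (involutive V) (allowed V))

    snoc-valid⁻ : ∀ {s n} → Valid S n (Q ++ (r , s , N) ∷ []) → Valid S N Q
    snoc-valid⁻ V = mkValid refl (λ i<j p q → sorted V i<j (At-++ˡ p) (At-++ˡ q)) (λ p → positive V (At-++ˡ p))
      inv (λ p p′ → allowed V (At-++ˡ p) (At-++ˡ p′))
      where
      inv : Involutive Q
      inv p with involutive V (At-++ˡ p)
      ... | c , p′ with At-snoc⁻ Q p′
      ...   | inj₁ (refl , refl) = ⊥-elim (<-irrefl refl (At-< p))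
      ...   | inj₂ u             = c , u

-- Enumeration of words by removing the largest letter.

module Peeling where

  open Positions
  open ColouredWords
  open Valid
  open import Data.Nat using (_<?_; _<ᵇ_)
  open import Data.Nat.Properties

  ++-injective : ∀ {A : Set} (ws xs : List A) {ys zs} → length ws ≡ length xs → ws ++ ys ≡ xs ++ zs →
                 ws ≡ xs × ys ≡ zs
  ++-injective []       []       _   eq = refl , eq
  ++-injective (w ∷ ws) (x ∷ xs) len eq with ∷-injective eq
  ... | refl , eq′ with ++-injective ws xs (suc-injective len) eq′
  ...   | refl , eq″ = refl , eq″

  unique-map : ∀ {A B : Set} (f : A → B) {xs} → (∀ {x y} → x ∈ xs → y ∈ xs → f x ≡ f y → x ≡ y) →
               Unique xs → Unique (map f xs)
  unique-map f inj []       = []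
  unique-map f inj (p ∷ ps) = All.tabulate fresh ∷ unique-map f (λ x∈ y∈ → inj (there x∈) (there y∈)) ps
    where
    fresh : ∀ {y} → y ∈ map f _ → ¬ f _ ≡ y
    fresh y∈ eq with ∈-map⁻ f y∈
    ... | x , x∈ , refl = All.lookup p x∈ (inj (here refl) (there x∈) eq)

  low high : ℕ → List Entry → List Entry
  low  t = takeWhile (λ e → colour e <? t)
  high t = dropWhile (λ e → colour e <? t)

  pairInsert : Entry → List Entry → List Entry
  pairInsert ℓ@(r , s , c) q = double (low (threshold s c) q) (high (threshold s c) q) ℓ

  low++high : ∀ t q → low t q ++ high t q ≡ q
  low++high t = takeWhile++dropWhile (λ e → colour e <? t)

  Sorted-tail : ∀ {e q} → Sorted (e ∷ q) → Sorted q
  Sorted-tail so i<j p p′ = so (s≤s i<j) (there p) (there p′)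

  low-below : ∀ t q {i e} → At (low t q) i e → colour e < t
  low-below t (d ∷ q) p with colour d <ᵇ t | <ᵇ-reflects-< (colour d) t
  low-below t (d ∷ q) here      | true | ofʸ d<t = d<t
  low-below t (d ∷ q) (there p) | true | ofʸ d<t = low-below t q p

  high-above : ∀ t q → Sorted q → ∀ {i e} → At (high t q) i e → t ≤ colour e
  high-above t (d ∷ q) so p with colour d <ᵇ t | <ᵇ-reflects-< (colour d) t
  high-above t (d ∷ q) so p         | true | ofʸ _   = high-above t q (Sorted-tail so) p
  high-above t (d ∷ q) so here      | false | ofⁿ d≮t = ≮⇒≥ d≮t
  high-above t (d ∷ q) so (there p) | false | ofⁿ d≮t = ≤-trans (≮⇒≥ d≮t) (⊑⇒colour≤ (so (s≤s z≤n) here (there p)))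

  At-++⁻ˡ : ∀ {A : Set} (xs : List A) {ys i x} → i < length xs → At (xs ++ ys) i x → At xs i x
  At-++⁻ˡ (_ ∷ xs) _         here      = here
  At-++⁻ˡ (_ ∷ xs) (s≤s i<l) (there p) = there (At-++⁻ˡ xs i<l p)

  At-++⁻ʳ : ∀ {A : Set} (xs : List A) {ys i x} → length xs ≤ i → At (xs ++ ys) i x → ∃ λ j → At ys j x
  At-++⁻ʳ []       _         p         = _ , p
  At-++⁻ʳ (_ ∷ xs) (s≤s l≤i) (there p) = At-++⁻ʳ xs l≤i p

  low-high-cut : ∀ t q → Sorted q → Cut t (low t q) (high t q)
  low-high-cut t q so = mkCut
    (λ p i<l → low-below t q (At-++⁻ˡ _ i<l p))
    (λ p l≤i → high-above t q so (proj₂ (At-++⁻ʳ (low t q) l≤i p)))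

  cut-unique : ∀ {t} xs ys → Cut t xs ys → low t (xs ++ ys) ≡ xs × high t (xs ++ ys) ≡ ys
  cut-unique {t} [] [] cut = refl , refl
  cut-unique {t} [] (y ∷ ys) cut with colour y <ᵇ t | <ᵇ-reflects-< (colour y) t
  ... | true | ofʸ y<t = ⊥-elim (<⇒≱ y<t (Cut.above cut here z≤n))
  ... | false | ofⁿ _  = refl , refl
  cut-unique {t} (x ∷ xs) ys cut with colour x <ᵇ t | <ᵇ-reflects-< (colour x) t
  ... | false | ofⁿ x≮t = ⊥-elim (x≮t (Cut.below cut here (s≤s z≤n)))
  ... | true | ofʸ _ with cut-unique xs ys (mkCut (λ p i<l → Cut.below cut (there p) (s≤s i<l))
                                           (λ p l≤i → Cut.above cut (there p) (s≤s l≤i)))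
  ...   | eq₁ , eq₂ = cong (x ∷_) eq₁ , eq₂

  relabel-injective : ∀ j {d e} → relabel j d ≡ relabel j e → d ≡ e
  relabel-injective j eq with cong proj₁ eq | cong (λ e → proj₁ (proj₂ e)) eq
                            | skip-injective j (cong (λ e → proj₂ (proj₂ e)) eq)
  ... | refl | refl | refl = refl

  -- The last entry records the insertion point `length xs`, so equality of the results aligns the
  -- two cuts.
  double-injective : ∀ {ℓ} xs ys xs′ ys′ → double xs ys ℓ ≡ double xs′ ys′ ℓ → xs ++ ys ≡ xs′ ++ ys′
  double-injective xs ys xs′ ys′ eq with ∷ʳ-injective _ _ eq
  ... | eqQ , eqlast with cong (λ e → proj₂ (proj₂ e)) eqlast
  ...   | eqlen with ++-injective (map (relabel (length xs)) xs) (map (relabel (length xs′)) xs′)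
                       (trans (length-map _ xs) (trans eqlen (sym (length-map _ xs′)))) eqQ
  ...     | eqxs , eqys = cong₂ _++_
            (map-injective (relabel-injective _) (trans eqxs (cong (λ k → map (relabel k) xs′) (sym eqlen))))
            (map-injective (relabel-injective _) (trans (cong (λ { [] → [] ; (_ ∷ zs) → zs }) eqys)
                                                        (cong (λ k → map (relabel k) ys′) (sym eqlen))))

  pairInsert-injective : ∀ ℓ {q q′} → pairInsert ℓ q ≡ pairInsert ℓ q′ → q ≡ q′
  pairInsert-injective ℓ@(r , s , c) {q} {q′} eq = begin
    q                      ≡⟨ low++high t q ⟨
    low t q ++ high t q    ≡⟨ double-injective (low t q) (high t q) (low t q′) (high t q′) eq ⟩
    low t q′ ++ high t q′  ≡⟨ low++high t q′ ⟩
    q′                     ∎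
    where
    open ≡-Reasoning
    t = threshold s c

  record Enumerates (S : List Entry) (n : ℕ) (qs : List (List Entry)) : Set where
    constructor mkEnumerates
    field
      unique   : Unique qs
      sound    : ∀ {q} → q ∈ qs → Valid S n q
      complete : ∀ {q} → Valid S n q → q ∈ qs

  open Enumerates

  pairInsert-valid : ∀ {ℓ S n q} → PairLetter ℓ → Top ℓ S → Valid (ℓ ∷ S) n q →
                     Valid (ℓ ∷ S) (suc (suc n)) (pairInsert ℓ q)
  pairInsert-valid {ℓ@(r , s , c)} {S} {n} {q} pl top V =
    subst (λ k → Valid (ℓ ∷ S) (suc (suc k)) (pairInsert ℓ q))
      (trans (cong length (low++high t q)) (length≡ V))
      (double-valid pl top (low t q) (high t q) (low-high-cut t q (sorted V))
        (subst (λ p → Valid (ℓ ∷ S) (length p) p) (sym (low++high t q))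
          (subst (λ k → Valid (ℓ ∷ S) k q) (sym (length≡ V)) V)))
    where t = threshold s c

  double-pairInsert : ∀ {S N xs ys ℓ} → Valid S N (double xs ys ℓ) →
                      double xs ys ℓ ≡ pairInsert ℓ (xs ++ ys)
  double-pairInsert {xs = xs} {ys} {ℓ} V with cut-unique xs ys (double-cut {xs = xs} {ys} V)
  ... | eq₁ , eq₂ = cong₂ (λ as bs → double as bs ℓ) (sym eq₁) (sym eq₂)

  double-letter : ∀ {S n xs ys r s c} → Valid S n (double xs ys (r , s , c)) → c ≤ r → (r , s , c) ∈ S
  double-letter {xs = xs} {ys} V = allowed V (At-double-last xs ys) (At-double-mid xs ys)

  snoc-letter : ∀ {S n Q r s} → Valid S n (Q ++ (r , s , length Q) ∷ []) → (r , s , r) ∈ S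
  snoc-letter {Q = Q} V = allowed V (At-length Q) (At-length Q) ≤-refl

  pairLetter-≤ : ∀ {r s c} → PairLetter (r , s , c) → c ≤ r
  pairLetter-≤ (⊕-pair c<r)   = <⇒≤ c<r
  pairLetter-≤ (⊖-pair _ c≤r) = c≤r

  data Peeled (ℓ : Entry) (S : List Entry) (n : ℕ) : List Entry → Set where
    absent : ∀ {q} → Valid S n q → Peeled ℓ S n q
    single : ∀ Q {r s} → (r , s , r) ≡ ℓ → Peeled ℓ S n (Q ++ (r , s , length Q) ∷ [])
    paired : ∀ xs ys → Peeled ℓ S n (double xs ys ℓ)

  -- Inspecting the orbit of the last position suffices: if its letter is not `ℓ`, then `drop-top`
  -- shows that `ℓ` occurs nowhere.
  peel : ∀ {ℓ S n q} → Top ℓ S → ℓ ∉ S → Valid (ℓ ∷ S) n q → Peeled ℓ S n q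
  peel {q = q} top ℓ∉S V with initLast q
  ... | [] = absent (mkValid (length≡ V) (sorted V) (positive V) (involutive V) λ ())
  ... | Q ∷ʳ′ (a , s , m) with lastView {Q} (involutive V)
  ...   | inj₁ refl with snoc-letter {Q = Q} V
  ...     | here eq  = single Q eq
  ...     | there ∈S = absent (drop-top {Q = Q} top ℓ∉S V (At-length Q) ∈S)
  peel {ℓ} {S} {n} top ℓ∉S V | Q ∷ʳ′ (a , s , m) | inj₂ (xs , ys , c , eq)
    with subst (Valid (ℓ ∷ S) n) eq V
  ... | V′ with double-letter {xs = xs} {ys} V′ (pairLetter-≤ (double-pairLetter {xs = xs} {ys} V′))
  ...   | here refl = subst (Peeled ℓ S n) (sym eq) (paired xs ys)
  ...   | there ∈S with ∷ʳ-injective Q _ eq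
  ...     | eqQ , refl = absent (drop-top {Q = Q} top ℓ∉S V
                (subst (λ q → At q m (c , s , suc (length (xs ++ ys)))) (sym eq) (At-double-mid xs ys)) ∈S)

  Loopless : Entry → Set
  Loopless ℓ = ∀ {r s} → ¬ (r , s , r) ≡ ℓ

  module _ {ℓ : Entry} {S : List Entry} (top : Top ℓ S) (ℓ∉S : ℓ ∉ S) where

    paired∈ : ∀ {n xs ys qs} → Enumerates (ℓ ∷ S) n qs → Valid (ℓ ∷ S) (suc (suc n)) (double xs ys ℓ) →
              double xs ys ℓ ∈ map (pairInsert ℓ) qs
    paired∈ {n} {xs} {ys} {qs} E V = subst (_∈ map (pairInsert ℓ) qs) (sym (double-pairInsert {xs = xs} {ys} V))
      (∈-map⁺ (pairInsert ℓ) (complete E (subst (λ k → Valid (ℓ ∷ S) k (xs ++ ys))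
        (suc-injective (suc-injective (trans (sym (length-double xs ys)) (length≡ V))))
        (double-valid⁻ {xs = xs} {ys} V))))

    paired-length : ∀ {n xs ys} → Valid (ℓ ∷ S) n (double xs ys ℓ) → suc (suc (length (xs ++ ys))) ≡ n
    paired-length {xs = xs} {ys} V = trans (sym (length-double xs ys)) (length≡ V)

    paired∉ : PairLetter ℓ → ∀ {n n′ q qs qs′} → Enumerates S n qs → Enumerates (ℓ ∷ S) n′ qs′ →
              q ∈ qs → q ∉ map (pairInsert ℓ) qs′
    paired∉ pl E E′ q∈ q∈′ with ∈-map⁻ (pairInsert ℓ) q∈′
    ... | q′ , q′∈ , refl = ℓ∉S (double-letter {xs = low t q′} {high t q′} (sound E q∈) (pairLetter-≤ pl))
      where t = threshold (proj₁ (proj₂ ℓ)) (proj₂ (proj₂ ℓ))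

    pairs-unique : ∀ {n qs} → Enumerates (ℓ ∷ S) n qs → Unique (map (pairInsert ℓ) qs)
    pairs-unique E = unique-map (pairInsert ℓ) (λ _ _ → pairInsert-injective ℓ) (unique E)

    pairs-sound : PairLetter ℓ → ∀ {n q qs} → Enumerates (ℓ ∷ S) n qs → q ∈ map (pairInsert ℓ) qs →
                  Valid (ℓ ∷ S) (suc (suc n)) q
    pairs-sound pl E q∈ with ∈-map⁻ (pairInsert ℓ) q∈
    ... | q′ , q′∈ , refl = pairInsert-valid pl top (sound E q′∈)

    enumerates-zero : ∀ {qs} → Enumerates S 0 qs → Enumerates (ℓ ∷ S) 0 qs
    enumerates-zero E = mkEnumerates (unique E) (λ q∈ → weaken (sound E q∈)) comp
      where
      comp : ∀ {q} → Valid (ℓ ∷ S) 0 q → q ∈ _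
      comp {[]} V = complete E (mkValid refl (sorted V) (positive V) (involutive V) λ ())
      comp {_ ∷ _} V with length≡ V
      ... | ()

    enumerates-pair-one : Loopless ℓ → ∀ {qs} → Enumerates S 1 qs → Enumerates (ℓ ∷ S) 1 qs
    enumerates-pair-one loopless E = mkEnumerates (unique E) (λ q∈ → weaken (sound E q∈)) comp
      where
      comp : ∀ {q} → Valid (ℓ ∷ S) 1 q → q ∈ _
      comp V with peel top ℓ∉S V
      ... | absent V′ = complete E V′
      ... | single Q eq = ⊥-elim (loopless eq)
      ... | paired xs ys with paired-length {xs = xs} {ys} V
      ...   | ()

    -- The factor 1/(1 - u²) in the form `E′ = E + u² E′`: removing one copy of `ℓ` may leave
    -- further copies, so the second list is again over `ℓ ∷ S`.
    enumerates-pair : Loopless ℓ → PairLetter ℓ → ∀ {n qs qs′} →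
                      Enumerates S (suc (suc n)) qs → Enumerates (ℓ ∷ S) n qs′ →
                      Enumerates (ℓ ∷ S) (suc (suc n)) (qs ++ map (pairInsert ℓ) qs′)
    enumerates-pair loopless pl {n} {qs} {qs′} E E′ = mkEnumerates
      (Uniqueₚ.++⁺ (unique E) (pairs-unique E′) (λ { (q∈ , q∈′) → paired∉ pl E E′ q∈ q∈′ })) snd comp
      where
      snd : ∀ {q} → q ∈ qs ++ map (pairInsert ℓ) qs′ → Valid (ℓ ∷ S) (suc (suc n)) q
      snd q∈ with ∈-++⁻ qs q∈
      ... | inj₁ q∈ = weaken (sound E q∈)
      ... | inj₂ q∈ = pairs-sound pl E′ q∈

      comp : ∀ {q} → Valid (ℓ ∷ S) (suc (suc n)) q → q ∈ qs ++ map (pairInsert ℓ) qs′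
      comp V with peel top ℓ∉S V
      ... | absent V′    = ∈-++⁺ˡ (complete E V′)
      ... | single Q eq  = ⊥-elim (loopless eq)
      ... | paired xs ys = ∈-++⁺ʳ qs (paired∈ {xs = xs} {ys} E′ V)

  snoc : Entry → List Entry → List Entry
  snoc e q = q ++ e ∷ []

  snoc-injective : ∀ {e} {p q : List Entry} → snoc e p ≡ snoc e q → p ≡ q
  snoc-injective eq = proj₁ (∷ʳ-injective _ _ eq)

  snoc-length : ∀ (Q : List Entry) {e} → length (snoc e Q) ≡ suc (length Q)
  snoc-length Q = trans (length-++ Q) (+-comm (length Q) 1)

  entry⊑⊕ : ∀ {S n q r} → Valid S n q → (∀ {e} → e ∈ S → colour e ≤ r) →
            ∀ {i d} → At q i d → d ⊑ (r , ⊕ , length q)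
  entry⊑⊕ V bound {d = a , t , m} p with m≤n⇒m<n∨m≡n (colour-≤ bound V p)
  ... | inj₁ a<r = colour< a<r
  entry⊑⊕ V bound {d = a , ⊖ , m} p | inj₂ refl = value≼ ⊖≼⊕
  entry⊑⊕ V bound {d = a , ⊕ , m} p | inj₂ refl = value≼ (⊕≼⊕ (<⇒≤ (index-< (involutive V) p)))

  module _ {r : ℕ} {S : List Entry} (top : Top (r , ⊕ , r) S) (ℓ∉S : (r , ⊕ , r) ∉ S) where

    private
      ℓ : Entry
      ℓ = r , ⊕ , r

    -- The factor 1/(1 - u) in the form `E′ = E + u E′`: a fixed point of the top letter can be
    -- appended any number of times.
    enumerates-fixed : ∀ {n qs qs′} → Enumerates S (suc n) qs → Enumerates (ℓ ∷ S) n qs′ →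
                       Enumerates (ℓ ∷ S) (suc n) (qs ++ map (snoc (r , ⊕ , n)) qs′)
    enumerates-fixed {n} {qs} {qs′} E E′ = mkEnumerates
      (Uniqueₚ.++⁺ (unique E) (unique-map (snoc e) (λ _ _ → snoc-injective) (unique E′)) disj) snd comp
      where
      e : Entry
      e = r , ⊕ , n

      disj : ∀ {q} → ¬ (q ∈ qs × q ∈ map (snoc e) qs′)
      disj (q∈ , q∈′) with ∈-map⁻ (snoc e) q∈′
      ... | Q , Q∈ , refl with length≡ (sound E′ Q∈)
      ...   | refl = ℓ∉S (snoc-letter {Q = Q} (sound E q∈))

      snd : ∀ {q} → q ∈ qs ++ map (snoc e) qs′ → Valid (ℓ ∷ S) (suc n) q
      snd q∈ with ∈-++⁻ qs q∈
      ... | inj₁ q∈ = weaken (sound E q∈)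
      ... | inj₂ q∈ with ∈-map⁻ (snoc e) q∈
      ...   | Q , Q∈ , refl with sound E′ Q∈
      ...     | V with length≡ V
      ...       | refl = snoc-valid (here refl) V (entry⊑⊕ V (λ e∈ → ⊑⇒colour≤ (top-∷ top e∈))) bottom⊑
        where
        bottom⊑ : bottom ⊑ (r , ⊕ , n)
        bottom⊑ with m≤n⇒m<n∨m≡n (z≤n {r})
        ... | inj₁ 0<r  = colour< 0<r
        ... | inj₂ refl = value≼ (⊕≼⊕ z≤n)

      comp : ∀ {q} → Valid (ℓ ∷ S) (suc n) q → q ∈ qs ++ map (snoc e) qs′
      comp V with peel top ℓ∉S V
      ... | absent V′ = ∈-++⁺ˡ (complete E V′)
      ... | single Q refl with suc-injective (trans (sym (snoc-length Q)) (length≡ V))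
      ...   | refl = ∈-++⁺ʳ qs (∈-map⁺ (snoc e) (complete E′ (snoc-valid⁻ V)))
      comp V | paired xs ys with double-pairLetter {xs = xs} {ys} V
      -- A positive 2-cycle has ends of different colours, so the letter `(r , ⊕ , r)` never comes
      -- from one.
      ... | ⊕-pair r<r = ⊥-elim (<-irrefl refl r<r)

  module _ {r : ℕ} {S : List Entry} (0<r : 0 < r) (smaller : ∀ {e} → e ∈ S → colour e < r) where

    private
      ℓ : Entry
      ℓ = r , ⊖ , r

      ℓ∉S : ℓ ∉ S
      ℓ∉S ℓ∈S = <-irrefl refl (smaller ℓ∈S)

      top : Top ℓ S
      top e∈S = colour< (smaller e∈S)

      loop-sound : ∀ {n q qs} → Enumerates S n qs → q ∈ map (snoc (r , ⊖ , n)) qs → Valid (ℓ ∷ S) (suc n) q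
      loop-sound {n} E q∈ with ∈-map⁻ (snoc (r , ⊖ , n)) q∈
      ... | Q , Q∈ , refl with sound E Q∈
      ...   | V with length≡ V
      ...     | refl = snoc-valid (here refl) (weaken V) (λ p → colour< (below p)) (colour< 0<r)
        where
        below : ∀ {i d} → At Q i d → colour d < r
        below {d = a , s , m} p with involutive V p
        ... | c , p′ with ≤-total c a
        ...   | inj₁ c≤a = smaller (allowed V p p′ c≤a)
        ...   | inj₂ a≤c = ≤-<-trans a≤c (smaller (allowed V p′ p a≤c))

      loop∉ : ∀ {n q qs qs′} → Enumerates S (suc n) qs → Enumerates S n qs′ →
              q ∈ qs → q ∉ map (snoc (r , ⊖ , n)) qs′
      loop∉ {n} E E′ q∈ q∈′ with ∈-map⁻ (snoc (r , ⊖ , n)) q∈′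
      ... | Q , Q∈ , refl with length≡ (sound E′ Q∈)
      ...   | refl = ℓ∉S (snoc-letter {Q = Q} (sound E q∈))

      loops-unique : ∀ {n qs} → Enumerates S n qs → Unique (map (snoc (r , ⊖ , n)) qs)
      loops-unique E = unique-map (snoc _) (λ _ _ → snoc-injective) (unique E)

      -- Reversal on the block of colour r leaves no room for a fixed -n next to other entries.
      loop-valid⁻ : ∀ {n Q} → Valid (ℓ ∷ S) n (snoc (r , ⊖ , length Q) Q) → Valid S (length Q) Q
      loop-valid⁻ {Q = Q} V = mkValid (length≡ V⁻) (sorted V⁻) (positive V⁻) (involutive V⁻) allowed′
        where
        V⁻ = snoc-valid⁻ {Q = Q} V

        unlooped : ∀ {i m e} → m < length Q → At Q i e → e ⊑ (r , ⊖ , length Q) → ¬ e ≡ (r , ⊖ , m)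
        unlooped m<N p (value≼ (⊖≼⊖ N≤m)) refl = <⇒≱ m<N N≤m
        unlooped m<N p (colour< r<r)      refl = <-irrefl refl r<r

        allowed′ : Allowed S Q
        allowed′ {i} {a} {s} {m} p p′ c≤a with allowed V⁻ p p′ c≤a
        ... | there ∈S  = ∈S
        ... | here refl = ⊥-elim (unlooped (At-< p′) p (sorted V (At-< p) (At-++ˡ p) (At-length Q)) refl)

      loop∈ : ∀ {n Q qs} → Enumerates S n qs → Valid (ℓ ∷ S) (suc n) (snoc (r , ⊖ , length Q) Q) →
              snoc (r , ⊖ , length Q) Q ∈ map (snoc (r , ⊖ , n)) qs
      loop∈ {Q = Q} E V with suc-injective (trans (sym (snoc-length Q)) (length≡ V))
      ... | refl = ∈-map⁺ (snoc _) (complete E (loop-valid⁻ {Q = Q} V))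

    enumerates-loop-one : ∀ {qs qs′} → Enumerates S 1 qs → Enumerates S 0 qs′ →
                          Enumerates (ℓ ∷ S) 1 (qs ++ map (snoc (r , ⊖ , 0)) qs′)
    enumerates-loop-one {qs} {qs′} E E′ = mkEnumerates
      (Uniqueₚ.++⁺ (unique E) (loops-unique E′) (λ { (q∈ , q∈′) → loop∉ E E′ q∈ q∈′ })) snd comp
      where
      snd : ∀ {q} → q ∈ qs ++ map (snoc (r , ⊖ , 0)) qs′ → Valid (ℓ ∷ S) 1 q
      snd q∈ with ∈-++⁻ qs q∈
      ... | inj₁ q∈ = weaken (sound E q∈)
      ... | inj₂ q∈ = loop-sound E′ q∈

      comp : ∀ {q} → Valid (ℓ ∷ S) 1 q → q ∈ qs ++ map (snoc (r , ⊖ , 0)) qs′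
      comp V with peel top ℓ∉S V
      ... | absent V′     = ∈-++⁺ˡ (complete E V′)
      ... | single Q refl = ∈-++⁺ʳ qs (loop∈ {Q = Q} E′ V)
      ... | paired xs ys with trans (sym (length-double xs ys)) (length≡ V)
      ...   | ()

    -- The recursion `E′ = E + u E + u² E′`: a word can end in a fixed `-n` of colour `r` only if
    -- the rest avoids `ℓ`, whereas 2-cycles with letter `ℓ` can be removed repeatedly.
    enumerates-loop : ∀ {n qs qs′ qs″} → Enumerates S (suc (suc n)) qs → Enumerates S (suc n) qs′ →
                      Enumerates (ℓ ∷ S) n qs″ →
                      Enumerates (ℓ ∷ S) (suc (suc n))
                        (qs ++ (map (snoc (r , ⊖ , suc n)) qs′ ++ map (pairInsert ℓ) qs″))
    enumerates-loop {n} {qs} {qs′} {qs″} E E′ E″ = mkEnumerates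
      (Uniqueₚ.++⁺ (unique E) (Uniqueₚ.++⁺ (loops-unique E′) (pairs-unique top ℓ∉S E″) disj″) disj) snd comp
      where
      pl : PairLetter ℓ
      pl = ⊖-pair 0<r ≤-refl

      disj″ : ∀ {q} → ¬ (q ∈ map (snoc (r , ⊖ , suc n)) qs′ × q ∈ map (pairInsert ℓ) qs″)
      disj″ (q∈′ , q∈″) with ∈-map⁻ (snoc _) q∈′ | ∈-map⁻ (pairInsert ℓ) q∈″
      -- The last entry of a loop has index `suc n`; that of a 2-cycle stores its insertion point,
      -- which is at most `n`.
      ... | Q , _ , refl | q , q∈ , eq = <-irrefl (sym (cong (λ e → proj₂ (proj₂ e)) (proj₂ (∷ʳ-injective Q _ eq))))
        (s≤s (≤-trans (length-≤-++ (low r q) (high r q))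
          (≤-reflexive (trans (cong length (low++high r q)) (length≡ (sound E″ q∈))))))

      disj : ∀ {q} → ¬ (q ∈ qs × q ∈ map (snoc (r , ⊖ , suc n)) qs′ ++ map (pairInsert ℓ) qs″)
      disj (q∈ , q∈′) with ∈-++⁻ (map (snoc _) qs′) q∈′
      ... | inj₁ q∈″ = loop∉ E E′ q∈ q∈″
      ... | inj₂ q∈″ = paired∉ top ℓ∉S pl E E″ q∈ q∈″

      snd : ∀ {q} → q ∈ qs ++ (map (snoc (r , ⊖ , suc n)) qs′ ++ map (pairInsert ℓ) qs″) →
            Valid (ℓ ∷ S) (suc (suc n)) q
      snd q∈ with ∈-++⁻ qs q∈
      ... | inj₁ q∈ = weaken (sound E q∈)
      ... | inj₂ q∈ with ∈-++⁻ (map (snoc _) qs′) q∈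
      ...   | inj₁ q∈ = loop-sound E′ q∈
      ...   | inj₂ q∈ = pairs-sound top ℓ∉S pl E″ q∈

      comp : ∀ {q} → Valid (ℓ ∷ S) (suc (suc n)) q →
             q ∈ qs ++ (map (snoc (r , ⊖ , suc n)) qs′ ++ map (pairInsert ℓ) qs″)
      comp V with peel top ℓ∉S V
      ... | absent V′     = ∈-++⁺ˡ (complete E V′)
      ... | single Q refl = ∈-++⁺ʳ qs (∈-++⁺ˡ (loop∈ {Q = Q} E′ V))
      ... | paired xs ys  = ∈-++⁺ʳ qs (∈-++⁺ʳ (map (snoc _) qs′) (paired∈ top ℓ∉S {xs = xs} {ys} E″ V))

-- The differential equation of the product, coefficientwise.

module ProductSeries where

  open import Data.Integer using (_+_; _*_; _-_; -_) renaming (suc to sucℤ)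

  -- The differential equation (1 - u²) g′ = (p (1 + u) + 2 d u) g satisfied by
  -- (1 - u)^{-p} (1 - u²)^{-d}, coefficientwise.
  record Product (p d : ℤ) (g : ℕ → ℤ) : Set where
    constructor mkProduct
    field
      one  : g 1 ≡ p * g 0
      step : ∀ n → + (2 ℕ.+ n) * g (2 ℕ.+ n) ≡ p * g (suc n) + (+ n + p + + 2 * d) * g n

  open Product

  module _ {p d : ℤ} {g h : ℕ → ℤ} (G : Product p d g) where

    private
      from-difference : ∀ {x y z} → x ≡ y + z → y ≡ x - z
      from-difference {y = y} {z} refl = lemma y z
        where
        lemma : ∀ y z → y ≡ y + z - z
        lemma = solve-∀

      -- Reasoning modulo a known equation: after adding `a` times `u ≡ v`, the goal is a ring
      -- identity.
      replace : ∀ a b {u v} w → u ≡ v → w + a * (u - v) ≡ b → w ≡ b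
      replace a b {u} w refl eq = trans (lemma a u w) eq
        where
        lemma : ∀ a u w → w ≡ w + a * (u - u)
        lemma = solve-∀

    -- Here `h = g / (1 - u)`. With `g` written as differences of `h`, the equation for `g` is 1 - u
    -- times that for `h`, that is, a difference of consecutive equations. Each equation for `h`
    -- thus follows from the one before it.
    product-single : h 0 ≡ g 0 → (∀ n → h (suc n) ≡ g (suc n) + h n) → Product (sucℤ p) d h
    product-single h₀ hs = mkProduct h₁ hstep
      where
      h₁ : h 1 ≡ sucℤ p * h 0
      h₁ = trans (hs 0) (trans (cong₂ _+_ (trans (one G) (cong (p *_) (sym h₀))) refl) (lemma p (h 0)))
        where
        lemma : ∀ p x → p * x + x ≡ (+ 1 + p) * x
        lemma = solve-∀

      gs : ∀ n → g (suc n) ≡ h (suc n) - h n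
      gs n = from-difference (hs n)

      hstep : ∀ n → + (2 ℕ.+ n) * h (2 ℕ.+ n) ≡
              sucℤ p * h (suc n) + (+ n + sucℤ p + + 2 * d) * h n
      hstep n = begin
        N₂ * h (2 ℕ.+ n)                    ≡⟨ cong (N₂ *_) (hs (suc n)) ⟩
        N₂ * (g (2 ℕ.+ n) + h (suc n))      ≡⟨ lemma₁ N₂ (g (2 ℕ.+ n)) (h (suc n)) ⟩
        N₂ * g (2 ℕ.+ n) + N₂ * h (suc n)   ≡⟨ cong (_+ N₂ * h (suc n)) (step G n) ⟩
        p * g (suc n) + (+ n + p + + 2 * d) * g n + N₂ * h (suc n)
          ≡⟨ cong (λ x → p * x + (+ n + p + + 2 * d) * g n + N₂ * h (suc n)) (gs n) ⟩
        p * (h (suc n) - h n) + (+ n + p + + 2 * d) * g n + N₂ * h (suc n)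
          ≡⟨ go n ⟩
        sucℤ p * h (suc n) + (+ n + sucℤ p + + 2 * d) * h n ∎
        where
        open ≡-Reasoning
        N₂ = + (2 ℕ.+ n)
        lemma₁ : ∀ a b c → a * (b + c) ≡ a * b + a * c
        lemma₁ = solve-∀

        go : ∀ n → p * (h (suc n) - h n) + (+ n + p + + 2 * d) * g n + + (2 ℕ.+ n) * h (suc n) ≡
                   sucℤ p * h (suc n) + (+ n + sucℤ p + + 2 * d) * h n
        go zero = begin
          p * (h 1 - h 0) + (+ 0 + p + + 2 * d) * g 0 + + 2 * h 1
            ≡⟨ cong (λ x → p * (h 1 - h 0) + (+ 0 + p + + 2 * d) * x + + 2 * h 1) h₀ ⟨
          p * (h 1 - h 0) + (+ 0 + p + + 2 * d) * h 0 + + 2 * h 1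
            ≡⟨ replace (- + 1) _ _ h₁ (lemma p d (h 0) (h 1)) ⟩
          sucℤ p * h 1 + (+ 0 + sucℤ p + + 2 * d) * h 0 ∎
          where
          lemma : ∀ p d x y → p * (y - x) + (+ 0 + p + + 2 * d) * x + + 2 * y + (- + 1) * (y - (+ 1 + p) * x)
                  ≡ (+ 1 + p) * y + (+ 0 + (+ 1 + p) + + 2 * d) * x
          lemma = solve-∀
        go (suc n) = begin
          p * (h (suc (suc n)) - h (suc n)) + (+ suc n + p + + 2 * d) * g (suc n) + + (3 ℕ.+ n) * h (suc (suc n))
            ≡⟨ cong (λ x → p * (h (suc (suc n)) - h (suc n)) + (+ suc n + p + + 2 * d) * x + + (3 ℕ.+ n) * h (suc (suc n))) (gs n) ⟩
          p * (h (suc (suc n)) - h (suc n)) + (+ suc n + p + + 2 * d) * (h (suc n) - h n) + + (3 ℕ.+ n) * h (suc (suc n))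
            ≡⟨ replace (- + 1) _ _ (hstep n) (lemma (+ n) p d (h n) (h (suc n)) (h (suc (suc n)))) ⟩
          sucℤ p * h (suc (suc n)) + (+ suc n + sucℤ p + + 2 * d) * h (suc n) ∎
          where
          lemma : ∀ n p d x y z →
                  p * (z - y) + (+ 1 + n + p + + 2 * d) * (y - x) + (+ 3 + n) * z
                    + (- + 1) * ((+ 2 + n) * z - ((+ 1 + p) * y + (n + (+ 1 + p) + + 2 * d) * x))
                  ≡ (+ 1 + p) * z + (+ 1 + n + (+ 1 + p) + + 2 * d) * y
          lemma = solve-∀

    -- Here `h = g / (1 - u²)`, and the factor 1 - u² relates equations two steps apart. The
    -- induction therefore has two starting cases; the one at 1 rests on `h 1 ≡ p * h 0`.
    product-pair : h 0 ≡ g 0 → h 1 ≡ g 1 → (∀ n → h (2 ℕ.+ n) ≡ g (2 ℕ.+ n) + h n) → Product p (sucℤ d) h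
    product-pair h₀ h₁ hs = mkProduct (trans h₁ h₁′) hstep
      where
      open ≡-Reasoning

      h₁′ : g 1 ≡ p * h 0
      h₁′ = trans (one G) (cong (p *_) (sym h₀))

      gs : ∀ n → g (2 ℕ.+ n) ≡ h (2 ℕ.+ n) - h n
      gs n = from-difference (hs n)

      N₂ : ℕ → ℤ
      N₂ n = + (2 ℕ.+ n)

      hstep : ∀ n → N₂ n * h (2 ℕ.+ n) ≡ p * h (suc n) + (+ n + p + + 2 * sucℤ d) * h n
      hstep n = begin
        N₂ n * h (2 ℕ.+ n)                    ≡⟨ cong (N₂ n *_) (hs n) ⟩
        N₂ n * (g (2 ℕ.+ n) + h n)      ≡⟨ lemma₁ (N₂ n) (g (2 ℕ.+ n)) (h n) ⟩
        N₂ n * g (2 ℕ.+ n) + N₂ n * h n   ≡⟨ cong (_+ N₂ n * h n) (step G n) ⟩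
        p * g (suc n) + (+ n + p + + 2 * d) * g n + N₂ n * h n ≡⟨ go n ⟩
        p * h (suc n) + (+ n + p + + 2 * sucℤ d) * h n ∎
        where
        lemma₁ : ∀ a b c → a * (b + c) ≡ a * b + a * c
        lemma₁ = solve-∀

        go : ∀ n → p * g (suc n) + (+ n + p + + 2 * d) * g n + N₂ n * h n ≡
                   p * h (suc n) + (+ n + p + + 2 * sucℤ d) * h n
        go zero = begin
          p * g 1 + (+ 0 + p + + 2 * d) * g 0 + + 2 * h 0
            ≡⟨ cong₂ (λ x y → p * x + (+ 0 + p + + 2 * d) * y + + 2 * h 0) h₁ h₀ ⟨
          p * h 1 + (+ 0 + p + + 2 * d) * h 0 + + 2 * h 0
            ≡⟨ lemma p d (h 0) (h 1) ⟩
          p * h 1 + (+ 0 + p + + 2 * sucℤ d) * h 0 ∎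
          where
          lemma : ∀ p d x y → p * y + (+ 0 + p + + 2 * d) * x + + 2 * x ≡ p * y + (+ 0 + p + + 2 * (+ 1 + d)) * x
          lemma = solve-∀
        go (suc zero) = begin
          p * g 2 + (+ 1 + p + + 2 * d) * g 1 + + 3 * h 1
            ≡⟨ cong₂ (λ x y → p * x + (+ 1 + p + + 2 * d) * y + + 3 * h 1) (gs 0) (sym h₁) ⟩
          p * (h 2 - h 0) + (+ 1 + p + + 2 * d) * h 1 + + 3 * h 1
            ≡⟨ replace (- + 1) _ _ (trans h₁ h₁′) (lemma p d (h 0) (h 1) (h 2)) ⟩
          p * h 2 + (+ 1 + p + + 2 * sucℤ d) * h 1 ∎
          where
          lemma : ∀ p d x y z → p * (z - x) + (+ 1 + p + + 2 * d) * y + + 3 * y + (- + 1) * (y - p * x)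
                  ≡ p * z + (+ 1 + p + + 2 * (+ 1 + d)) * y
          lemma = solve-∀
        go (suc (suc n)) = begin
          p * g (3 ℕ.+ n) + (+ suc (suc n) + p + + 2 * d) * g (2 ℕ.+ n) + + (4 ℕ.+ n) * h (2 ℕ.+ n)
            ≡⟨ cong₂ (λ x y → p * x + (+ suc (suc n) + p + + 2 * d) * y + + (4 ℕ.+ n) * h (2 ℕ.+ n)) (gs (suc n)) (gs n) ⟩
          p * (h (3 ℕ.+ n) - h (suc n)) + (+ suc (suc n) + p + + 2 * d) * (h (2 ℕ.+ n) - h n) + + (4 ℕ.+ n) * h (2 ℕ.+ n)
            ≡⟨ replace (- + 1) _ _ (hstep n) (lemma (+ n) p d (h n) (h (suc n)) (h (2 ℕ.+ n)) (h (3 ℕ.+ n))) ⟩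
          p * h (3 ℕ.+ n) + (+ suc (suc n) + p + + 2 * sucℤ d) * h (2 ℕ.+ n) ∎
          where
          lemma : ∀ n p d x y z w → p * (w - y) + (+ 2 + n + p + + 2 * d) * (z - x) + (+ 4 + n) * z
                    + (- + 1) * ((+ 2 + n) * z - (p * y + (n + p + + 2 * (+ 1 + d)) * x))
                  ≡ p * w + (+ 2 + n + p + + 2 * (+ 1 + d)) * z
          lemma = solve-∀

-- The alphabet of orbits with colours at most r.

module Alphabet where

  open Positions
  open ColouredWords
  open Valid
  open Peeling
  open ProductSeries
  open import Data.Nat using (_+_)
  open import Data.Nat.Properties

  -- p and d are the numbers of letters of S that cover one and two positions.
  record Counted (p d : ℤ) (S : List Entry) : Set where
    constructor mkCounted
    field
      lists      : ℕ → List (List Entry)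
      enumerates : ∀ n → Enumerates S n (lists n)
      product    : Product p d (λ n → + length (lists n))

  open Counted

  length-++-map : ∀ {A B : Set} (f : A → B) (xs : List B) (ys : List A) →
                  + length (xs ++ map f ys) ≡ + length xs ℤ.+ + length ys
  length-++-map f xs ys = trans (cong +_ (trans (length-++ xs) (cong (λ k → length xs + k) (length-map f ys))))
                                (ℤₚ.pos-+ (length xs) (length ys))

  counted-[] : Counted (+ 0) (+ 0) []
  counted-[] = mkCounted E enum (mkProduct refl (λ n → lemma n))
    where
    E : ℕ → List (List Entry)
    E zero    = [] ∷ []
    E (suc _) = []

    lemma : ∀ n → + (2 + n) ℤ.* + length (E (2 + n)) ≡
            + 0 ℤ.* + length (E (suc n)) ℤ.+ (+ n ℤ.+ + 0 ℤ.+ + 2 ℤ.* + 0) ℤ.* + length (E n)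
    lemma zero    = refl
    lemma (suc n) = zeros (+ suc n)
      where
      zeros : ∀ x → (+ 2 ℤ.+ x) ℤ.* + 0 ≡ + 0 ℤ.* + 0 ℤ.+ (x ℤ.+ + 0 ℤ.+ + 2 ℤ.* + 0) ℤ.* + 0
      zeros = solve-∀

    -- In every cycle the end of larger colour must have its letter in the alphabet, so no entry is
    -- possible.
    empty : ∀ {n q} → Valid [] n q → q ≡ []
    empty {q = []}            V = refl
    empty {q = (a , s , m) ∷ q} V with involutive V here
    ... | c , p with ≤-total c a
    ...   | inj₁ c≤a with allowed V here p c≤a
    ...     | ()
    empty {q = (a , s , m) ∷ q} V | c , p | inj₂ a≤c with allowed V p here a≤c
    ... | ()

    enum : ∀ n → Enumerates [] n (E n)
    enum zero = mkEnumerates (All.[] ∷ [])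
      (λ { (here refl) → mkValid refl (λ _ ()) (λ ()) (λ ()) λ () })
      (λ V → here (empty V))
    enum (suc n) = mkEnumerates [] (λ ()) comp
      where
      comp : ∀ {q} → Valid [] (suc n) q → q ∈ []
      comp V with empty V
      ... | refl with length≡ V
      ...   | ()

  module _ {p d : ℤ} {S : List Entry} (C : Counted p d S) where

    private
      E = lists C

    module _ {ℓ : Entry} (top : Top ℓ S) (ℓ∉S : ℓ ∉ S) (pl : PairLetter ℓ) (loopless : Loopless ℓ) where

      private
        E′ : ℕ → List (List Entry)
        E′ zero          = E 0
        E′ (suc zero)    = E 1
        E′ (suc (suc n)) = E (2 + n) ++ map (pairInsert ℓ) (E′ n)

        enum : ∀ n → Enumerates (ℓ ∷ S) n (E′ n)
        enum zero          = enumerates-zero top ℓ∉S (enumerates C 0)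
        enum (suc zero)    = enumerates-pair-one top ℓ∉S loopless (enumerates C 1)
        enum (suc (suc n)) = enumerates-pair top ℓ∉S loopless pl (enumerates C (2 + n)) (enum n)

      counted-pair : Counted p (ℤ.suc d) (ℓ ∷ S)
      counted-pair = mkCounted E′ enum
        (product-pair (product C) refl refl (λ n → length-++-map (pairInsert ℓ) (E (2 + n)) (E′ n)))

    module _ {r : ℕ} (top : Top (r , ⊕ , r) S) (ℓ∉S : (r , ⊕ , r) ∉ S) where

      private
        E′ : ℕ → List (List Entry)
        E′ zero    = E 0
        E′ (suc n) = E (suc n) ++ map (snoc (r , ⊕ , n)) (E′ n)

        enum : ∀ n → Enumerates ((r , ⊕ , r) ∷ S) n (E′ n)
        enum zero    = enumerates-zero top ℓ∉S (enumerates C 0)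
        enum (suc n) = enumerates-fixed top ℓ∉S (enumerates C (suc n)) (enum n)

      counted-fixed : Counted (ℤ.suc p) d ((r , ⊕ , r) ∷ S)
      counted-fixed = mkCounted E′ enum
        (product-single (product C) refl (λ n → length-++-map (snoc (r , ⊕ , n)) (E (suc n)) (E′ n)))

    module _ {r : ℕ} (0<r : 0 < r) (smaller : ∀ {e} → e ∈ S → colour e < r) where

      private
        ℓ : Entry
        ℓ = r , ⊖ , r

        E′ : ℕ → List (List Entry)
        E′ zero          = E 0
        E′ (suc zero)    = E 1 ++ map (snoc (r , ⊖ , 0)) (E 0)
        E′ (suc (suc n)) = E (2 + n) ++ (map (snoc (r , ⊖ , suc n)) (E (suc n)) ++ map (pairInsert ℓ) (E′ n))

        enum : ∀ n → Enumerates (ℓ ∷ S) n (E′ n)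
        enum zero          = enumerates-zero (λ e∈ → colour< (smaller e∈)) (λ e∈ → <-irrefl refl (smaller e∈))
                               (enumerates C 0)
        enum (suc zero)    = enumerates-loop-one 0<r smaller (enumerates C 1) (enumerates C 0)
        enum (suc (suc n)) = enumerates-loop 0<r smaller (enumerates C (2 + n)) (enumerates C (suc n)) (enum n)

        -- (1 + u) / (1 - u²) = 1 / (1 - u)
        recursion : ∀ n → + length (E′ (suc n)) ≡ + length (E (suc n)) ℤ.+ + length (E′ n)
        recursion zero          = length-++-map (snoc (r , ⊖ , 0)) (E 1) (E 0)
        recursion (suc n) = begin
          + length (E′ (2 + n))
            ≡⟨ cong +_ (length-++ (E (2 + n))) ⟩
          + (length (E (2 + n)) + length (map (snoc (r , ⊖ , suc n)) (E (suc n)) ++ map (pairInsert ℓ) (E′ n)))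
            ≡⟨ ℤₚ.pos-+ (length (E (2 + n))) _ ⟩
          + length (E (2 + n)) ℤ.+ + length (map (snoc (r , ⊖ , suc n)) (E (suc n)) ++ map (pairInsert ℓ) (E′ n))
            ≡⟨ cong (λ k → + length (E (2 + n)) ℤ.+ k) (trans (length-++-map (pairInsert ℓ) (map (snoc _) (E (suc n))) (E′ n))
                 (cong (λ k → + k ℤ.+ + length (E′ n)) (length-map (snoc _) (E (suc n))))) ⟩
          + length (E (2 + n)) ℤ.+ (+ length (E (suc n)) ℤ.+ + length (E′ n))
            ≡⟨ cong (λ k → + length (E (2 + n)) ℤ.+ k) (recursion n) ⟨
          + length (E (2 + n)) ℤ.+ + length (E′ (suc n)) ∎
          where open ≡-Reasoning

      counted-loop : Counted (ℤ.suc p) d ((r , ⊖ , r) ∷ S)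
      counted-loop = mkCounted E′ enum (product-single (product C) refl recursion)

  positives : ℕ → ℕ → List Entry → List Entry
  positives r zero    S = S
  positives r (suc c) S = (r , ⊕ , c) ∷ positives r c S

  negatives : ℕ → ℕ → ℕ → List Entry → List Entry
  negatives r c zero    S = S
  negatives r c (suc k) S = (r , ⊖ , suc c) ∷ negatives r (suc c) k S

  -- The orbit representatives `(a , s , c)` with `c ≤ a`, in decreasing order: within colour `a`
  -- first `⊕` with `c` from `a` down to 0, then `⊖` with `c` from 1 up to `a`. The pair
  -- `(a , ⊖ , 0)` would repeat the orbit of `(a , ⊕ , 0)`.
  alphabet : ℕ → List Entry
  alphabet zero    = positives 0 1 []
  alphabet (suc r) = positives (suc r) (2 + r) (negatives (suc r) 0 (suc r) (alphabet r))

  ∈-positives⁻ : ∀ {r e S} c → e ∈ positives r c S → e ∈ S ⊎ ∃ λ x → e ≡ (r , ⊕ , x) × x < c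
  ∈-positives⁻ zero    e∈          = inj₁ e∈
  ∈-positives⁻ (suc c) (here refl) = inj₂ (c , refl , ≤-refl)
  ∈-positives⁻ (suc c) (there e∈) with ∈-positives⁻ c e∈
  ... | inj₁ e∈S             = inj₁ e∈S
  ... | inj₂ (x , refl , x<c) = inj₂ (x , refl , m<n⇒m<1+n x<c)

  ∈-negatives⁻ : ∀ {r e S} c k → e ∈ negatives r c k S → e ∈ S ⊎ ∃ λ x → e ≡ (r , ⊖ , x) × c < x
  ∈-negatives⁻ c zero    e∈          = inj₁ e∈
  ∈-negatives⁻ c (suc k) (here refl) = inj₂ (suc c , refl , ≤-refl)
  ∈-negatives⁻ c (suc k) (there e∈) with ∈-negatives⁻ (suc c) k e∈
  ... | inj₁ e∈S             = inj₁ e∈S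
  ... | inj₂ (x , refl , c<x) = inj₂ (x , refl , <⇒≤ c<x)

  ∈-positives⁺ˢ : ∀ {r e S} c → e ∈ S → e ∈ positives r c S
  ∈-positives⁺ˢ zero    e∈ = e∈
  ∈-positives⁺ˢ (suc c) e∈ = there (∈-positives⁺ˢ c e∈)

  ∈-positives⁺ : ∀ {r x S} c → x < c → (r , ⊕ , x) ∈ positives r c S
  ∈-positives⁺ (suc c) (s≤s x≤c) with m≤n⇒m<n∨m≡n x≤c
  ... | inj₁ x<c  = there (∈-positives⁺ c x<c)
  ... | inj₂ refl = here refl

  ∈-negatives⁺ˢ : ∀ {r e S} c k → e ∈ S → e ∈ negatives r c k S
  ∈-negatives⁺ˢ c zero    e∈ = e∈
  ∈-negatives⁺ˢ c (suc k) e∈ = there (∈-negatives⁺ˢ (suc c) k e∈)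

  ∈-negatives⁺ : ∀ {r x S} c k → c < x → x ≤ c + k → (r , ⊖ , x) ∈ negatives r c k S
  ∈-negatives⁺ c zero    c<x x≤c = ⊥-elim (<⇒≱ c<x (subst (_ ≤_) (+-identityʳ c) x≤c))
  ∈-negatives⁺ {x = x} c (suc k) c<x x≤c with m≤n⇒m<n∨m≡n c<x
  ... | inj₁ c<x′ = there (∈-negatives⁺ (suc c) k c<x′ (subst (x ≤_) (+-suc c k) x≤c))
  ... | inj₂ refl = here refl

  alphabet-bound : ∀ r {e} → e ∈ alphabet r → colour e ≤ r
  alphabet-bound zero    e∈ with ∈-positives⁻ 1 e∈
  ... | inj₂ (_ , refl , _) = z≤n
  alphabet-bound (suc r) e∈ with ∈-positives⁻ (2 + r) e∈
  ... | inj₂ (_ , refl , _) = ≤-refl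
  ... | inj₁ e∈′ with ∈-negatives⁻ 0 (suc r) e∈′
  ...   | inj₁ e∈″            = m≤n⇒m≤1+n (alphabet-bound r e∈″)
  ...   | inj₂ (_ , refl , _) = ≤-refl

  ∈-alphabet : ∀ r {a s c} → a ≤ r → c ≤ a → (s ≡ ⊖ → 0 < c) → (a , s , c) ∈ alphabet r
  ∈-alphabet zero    {s = ⊕} z≤n z≤n h = here refl
  ∈-alphabet zero    {s = ⊖} z≤n z≤n h with h refl
  ... | ()
  ∈-alphabet (suc r) a≤r c≤a h with m≤n⇒m<n∨m≡n a≤r
  ... | inj₁ (s≤s a≤r) = ∈-positives⁺ˢ (2 + r) (∈-negatives⁺ˢ 0 (suc r) (∈-alphabet r a≤r c≤a h))
  ∈-alphabet (suc r) {s = ⊕} a≤r c≤a h | inj₂ refl = ∈-positives⁺ (2 + r) (s≤s c≤a)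
  ∈-alphabet (suc r) {s = ⊖} a≤r c≤a h | inj₂ refl =
    ∈-positives⁺ˢ (2 + r) (∈-negatives⁺ 0 (suc r) (h refl) c≤a)

  -- By `c + suc k ≡ r` the innermost letter is `(r , ⊖ , r)`, added while all colours are still
  -- below `r`; it gives the single `suc p`. The other `k` letters have smaller third component and
  -- cover two positions each.
  counted-negatives : ∀ {p d S} r c k → c + suc k ≡ r → (∀ {e} → e ∈ S → colour e < r) → Counted p d S →
                      Counted (ℤ.suc p) (+ k ℤ.+ d) (negatives r c (suc k) S)
  counted-negatives {p} {d} {S} r c zero eq smaller C with trans (+-comm 1 c) eq
  ... | refl = subst (λ x → Counted (ℤ.suc p) x (negatives r c 1 S)) (lemma d) (counted-loop C (s≤s z≤n) smaller)
    where
    lemma : ∀ d → d ≡ + 0 ℤ.+ d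
    lemma = solve-∀
  counted-negatives {p} {d} {S} r c (suc k) eq smaller C =
    subst (λ x → Counted (ℤ.suc p) x (negatives r c (2 + k) S)) (lemma (+ k) d)
      (counted-pair (counted-negatives r (suc c) k eq′ smaller C) top fresh (⊖-pair (s≤s z≤n) (<⇒≤ c<r)) loopless)
    where
    lemma : ∀ k d → + 1 ℤ.+ (k ℤ.+ d) ≡ + 1 ℤ.+ k ℤ.+ d
    lemma = solve-∀

    eq′ : suc c + suc k ≡ r
    eq′ = trans (sym (+-suc c (suc k))) eq

    c<r : suc c < r
    c<r = subst (suc c <_) eq′ (m<m+n (suc c) (s≤s z≤n))

    top : Top (r , ⊖ , suc c) (negatives r (suc c) (suc k) S)
    top e∈ with ∈-negatives⁻ (suc c) (suc k) e∈
    ... | inj₁ e∈S              = colour< (smaller e∈S)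
    ... | inj₂ (x , refl , c<x) = value≼ (⊖≼⊖ (<⇒≤ c<x))

    fresh : (r , ⊖ , suc c) ∉ negatives r (suc c) (suc k) S
    fresh e∈ with ∈-negatives⁻ (suc c) (suc k) e∈
    ... | inj₁ e∈S              = <-irrefl refl (smaller e∈S)
    ... | inj₂ (x , refl , c<c) = <-irrefl refl c<c

    loopless : ∀ {a t} → ¬ (a , t , a) ≡ (r , ⊖ , suc c)
    loopless refl = <-irrefl refl c<r

  NonPositive : ℕ → List Entry → Set
  NonPositive r S = ∀ {e} → e ∈ S → colour e < r ⊎ ∃ λ x → e ≡ (r , ⊖ , x)

  top-positive : ∀ {S} r c → NonPositive r S → Top (r , ⊕ , c) (positives r c S)
  top-positive r c h e∈ with ∈-positives⁻ c e∈
  ... | inj₂ (x , refl , x<c) = value≼ (⊕≼⊕ (<⇒≤ x<c))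
  ... | inj₁ e∈S with h e∈S
  ...   | inj₁ a<r        = colour< a<r
  ...   | inj₂ (x , refl) = value≼ ⊖≼⊕

  fresh-positive : ∀ {S} r c → NonPositive r S → (r , ⊕ , c) ∉ positives r c S
  fresh-positive r c h e∈ with ∈-positives⁻ c e∈
  ... | inj₂ (x , refl , c<c) = <-irrefl refl c<c
  ... | inj₁ e∈S with h e∈S
  ...   | inj₁ r<r      = <-irrefl refl r<r
  ...   | inj₂ (x , ())

  counted-positives : ∀ {p d S} r c → c ≤ r → NonPositive r S → Counted p d S →
                      Counted p (+ c ℤ.+ d) (positives r c S)
  counted-positives {p} {d} {S} r zero    c≤r h C = subst (λ x → Counted p x S) (lemma d) C
    where
    lemma : ∀ d → d ≡ + 0 ℤ.+ d
    lemma = solve-∀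
  counted-positives {p} {d} {S} r (suc c) c<r h C =
    subst (λ x → Counted p x (positives r (suc c) S)) (lemma (+ c) d)
      (counted-pair (counted-positives r c (<⇒≤ c<r) h C) (top-positive r c h) (fresh-positive r c h) (⊕-pair c<r)
        λ { refl → <-irrefl refl c<r })
    where
    lemma : ∀ c d → + 1 ℤ.+ (c ℤ.+ d) ≡ + 1 ℤ.+ c ℤ.+ d
    lemma = solve-∀

  -- Colour `suc r` brings two letters covering one position, those with `c = suc r`, and
  -- `r + (r + 1)` letters covering two, which is the difference of consecutive squares.
  counted-alphabet : ∀ r → Counted (+ 2 ℤ.* + r ℤ.+ + 1) (+ r ℤ.* + r) (alphabet r)
  counted-alphabet zero    = counted-fixed counted-[] (top-positive 0 0 λ ()) (fresh-positive 0 0 λ ())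
  counted-alphabet (suc r) = subst₂ (λ p d → Counted p d (alphabet (suc r))) (lemma₁ (+ r)) (lemma₂ (+ r))
    (counted-fixed
      (counted-positives (suc r) (suc r) ≤-refl nonPositive
        (counted-negatives (suc r) 0 r refl (λ e∈ → s≤s (alphabet-bound r e∈)) (counted-alphabet r)))
      (top-positive (suc r) (suc r) nonPositive) (fresh-positive (suc r) (suc r) nonPositive))
    where
    nonPositive : NonPositive (suc r) (negatives (suc r) 0 (suc r) (alphabet r))
    nonPositive e∈ with ∈-negatives⁻ 0 (suc r) e∈
    ... | inj₁ e∈S            = inj₁ (s≤s (alphabet-bound r e∈S))
    ... | inj₂ (x , refl , _) = inj₂ (x , refl)

    lemma₁ : ∀ r → + 1 ℤ.+ (+ 1 ℤ.+ (+ 2 ℤ.* r ℤ.+ + 1)) ≡ + 2 ℤ.* (+ 1 ℤ.+ r) ℤ.+ + 1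
    lemma₁ = solve-∀

    lemma₂ : ∀ r → + 1 ℤ.+ r ℤ.+ (r ℤ.+ r ℤ.* r) ≡ (+ 1 ℤ.+ r) ℤ.* (+ 1 ℤ.+ r)
    lemma₂ = solve-∀

  -- Over the full alphabet the condition on letters reduces to the bound on colours: the partner of
  -- a negative entry is negative and above `bottom`, so its colour is positive, as `(a , ⊖ , c)`
  -- demands.
  valid-alphabet⁺ : ∀ {r n q} → length q ≡ n → Sorted q → (∀ {i e} → At q i e → bottom ⊑ e) → Involutive q →
                    (∀ {i e} → At q i e → colour e ≤ r) → Valid (alphabet r) n q
  valid-alphabet⁺ {r} {n} {q} len so po inv bound = mkValid len so po inv al
    where
    al : Allowed (alphabet r) q
    al {a = a} {s} {m} {c} p p′ c≤a = ∈-alphabet r (bound p) c≤a nonneg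
      where
      nonneg : s ≡ ⊖ → 0 < c
      nonneg refl with inv p
      ... | c′ , p″ with At-functional p″ p′
      ...   | refl with po p″
      ...     | colour< 0<c = 0<c

-- Prefix sums as division by 1 - t, and the passage from values to coefficients.

module PrefixSums where

  open import Data.Integer using (_+_; _*_; _-_)
  open import Data.Integer.Properties using (+-identityʳ)

  Seq : Set
  Seq = ℕ → ℤ

  -- On coefficients of a power series in t these are division by 1 - t, multiplication by t,
  -- multiplication by 1 - t, and t d/dt.
  prefix shift difference θ : Seq → Seq

  prefix a zero    = a 0
  prefix a (suc k) = a (suc k) + prefix a k

  shift a zero    = + 0
  shift a (suc k) = a k

  difference a k = a k - shift a k

  θ a k = + k * a k

  prefix^ : ℕ → Seq → Seq
  prefix^ zero    a = a
  prefix^ (suc m) a = prefix (prefix^ m a)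

  prefix-cong : ∀ {a b} → a ≗ b → prefix a ≗ prefix b
  prefix-cong e zero    = e 0
  prefix-cong e (suc k) = cong₂ _+_ (e (suc k)) (prefix-cong e k)

  shift-cong : ∀ {a b} → a ≗ b → shift a ≗ shift b
  shift-cong e zero    = refl
  shift-cong e (suc k) = e k

  prefix^-cong : ∀ m {a b} → a ≗ b → prefix^ m a ≗ prefix^ m b
  prefix^-cong zero    e = e
  prefix^-cong (suc m) e = prefix-cong (prefix^-cong m e)

  prefix^-prefix : ∀ m a → prefix^ m (prefix a) ≗ prefix (prefix^ m a)
  prefix^-prefix zero    a k = refl
  prefix^-prefix (suc m) a k = prefix-cong (prefix^-prefix m a) k

  prefix-unfold : ∀ a k → prefix a k ≡ a k + shift (prefix a) k
  prefix-unfold a zero    = sym (+-identityʳ (a 0))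
  prefix-unfold a (suc k) = refl

  prefix-shift : ∀ a → prefix (shift a) ≗ shift (prefix a)
  prefix-shift a zero    = refl
  prefix-shift a (suc k) = trans (cong (_+_ (a k)) (prefix-shift a k)) (sym (prefix-unfold a k))

  prefix^-shift : ∀ m a → prefix^ m (shift a) ≗ shift (prefix^ m a)
  prefix^-shift zero    a k = refl
  prefix^-shift (suc m) a k = trans (prefix-cong (prefix^-shift m a) k) (prefix-shift (prefix^ m a) k)

  prefix-difference : ∀ a → prefix (difference a) ≗ a
  prefix-difference a zero    = lemma (a 0)
    where
    lemma : ∀ x → x - + 0 ≡ x
    lemma = solve-∀
  prefix-difference a (suc k) = trans (cong (_+_ (a (suc k) - a k)) (prefix-difference a k)) (lemma (a (suc k)) (a k))
    where
    lemma : ∀ x y → x - y + y ≡ x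
    lemma = solve-∀

  difference-prefix : ∀ a → difference (prefix a) ≗ a
  difference-prefix a k = trans (cong (_- shift (prefix a) k) (prefix-unfold a k)) (lemma (a k) (shift (prefix a) k))
    where
    lemma : ∀ x y → x + y - y ≡ x
    lemma = solve-∀

  prefix-injective : ∀ {a b} → prefix a ≗ prefix b → a ≗ b
  prefix-injective {a} {b} e k = begin
    a k                      ≡⟨ difference-prefix a k ⟨
    difference (prefix a) k  ≡⟨ cong₂ _-_ (e k) (shift-cong e k) ⟩
    difference (prefix b) k  ≡⟨ difference-prefix b k ⟩
    b k                      ∎
    where open ≡-Reasoning

  prefix^-injective : ∀ m {a b} → prefix^ m a ≗ prefix^ m b → a ≗ b
  prefix^-injective zero    e = e
  prefix^-injective (suc m) e = prefix^-injective m (prefix-injective e)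

  prefix-linear : ∀ x y a b k → prefix (λ k → x * a k + y * b k) k ≡ x * prefix a k + y * prefix b k
  prefix-linear x y a b zero    = refl
  prefix-linear x y a b (suc k) = trans (cong (_+_ (x * a (suc k) + y * b (suc k))) (prefix-linear x y a b k))
    (lemma x y (a (suc k)) (b (suc k)) (prefix a k) (prefix b k))
    where
    lemma : ∀ x y u v p q → x * u + y * v + (x * p + y * q) ≡ x * (u + p) + y * (v + q)
    lemma = solve-∀

  prefix^-linear : ∀ m x y a b k → prefix^ m (λ k → x * a k + y * b k) k ≡ x * prefix^ m a k + y * prefix^ m b k
  prefix^-linear zero    x y a b k = refl
  prefix^-linear (suc m) x y a b k =
    trans (prefix-cong (prefix^-linear m x y a b) k) (prefix-linear x y (prefix^ m a) (prefix^ m b) k)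

  -- θ (1 - t)^{-1} = (1 - t)^{-1} (θ + t (1 - t)^{-1})
  θ-prefix : ∀ a k → θ (prefix a) k ≡ prefix (θ a) k + shift (prefix (prefix a)) k
  θ-prefix a zero    = sym (+-identityʳ (+ 0 * a 0))
  θ-prefix a (suc k) = begin
    (+ 1 + + k) * (a (suc k) + s)                            ≡⟨ lemma₁ (+ k) (a (suc k)) s ⟩
    (+ 1 + + k) * a (suc k) + (+ k * s + s)                  ≡⟨ cong (λ x → (+ 1 + + k) * a (suc k) + (x + s)) (θ-prefix a k) ⟩
    (+ 1 + + k) * a (suc k) + (prefix (θ a) k + shift (prefix (prefix a)) k + s)
      ≡⟨ lemma₂ ((+ 1 + + k) * a (suc k)) (prefix (θ a) k) (shift (prefix (prefix a)) k) s ⟩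
    (+ 1 + + k) * a (suc k) + prefix (θ a) k + (s + shift (prefix (prefix a)) k)
      ≡⟨ cong (_+_ ((+ 1 + + k) * a (suc k) + prefix (θ a) k)) (prefix-unfold (prefix a) k) ⟨
    (+ 1 + + k) * a (suc k) + prefix (θ a) k + prefix (prefix a) k ∎
    where
    open ≡-Reasoning
    s = prefix a k
    lemma₁ : ∀ k x s → (+ 1 + k) * (x + s) ≡ (+ 1 + k) * x + (k * s + s)
    lemma₁ = solve-∀
    lemma₂ : ∀ x p q s → x + (p + q + s) ≡ x + p + (s + q)
    lemma₂ = solve-∀

  -- The conjugate of θ by (1 - t)^m.
  θ⟨_⟩ : ℕ → Seq → Seq
  θ⟨ m ⟩ a k = θ a k + + m * shift (prefix a) k

  -- Each of the `m` factors 1/(1 - t) contributes the same commutator t/(1 - t), since prefix sums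
  -- and shifts commute.
  θ-prefix^ : ∀ m a → θ (prefix^ m a) ≗ prefix^ m (θ⟨ m ⟩ a)
  θ-prefix^ zero    a k = lemma (θ a k) (shift (prefix a) k)
    where
    lemma : ∀ x y → x ≡ x + + 0 * y
    lemma = solve-∀
  θ-prefix^ (suc m) a k = begin
    θ (prefix (prefix^ m a)) k
      ≡⟨ θ-prefix (prefix^ m a) k ⟩
    prefix (θ (prefix^ m a)) k + shift (prefix (prefix (prefix^ m a))) k
      ≡⟨ cong₂ _+_ (prefix-cong (θ-prefix^ m a) k) (sym lemma₁) ⟩
    prefix^ (suc m) (θ⟨ m ⟩ a) k + prefix^ (suc m) (shift (prefix a)) k
      ≡⟨ lemma₂ (prefix^ (suc m) (θ⟨ m ⟩ a) k) (prefix^ (suc m) (shift (prefix a)) k) ⟩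
    + 1 * prefix^ (suc m) (θ⟨ m ⟩ a) k + + 1 * prefix^ (suc m) (shift (prefix a)) k
      ≡⟨ prefix^-linear (suc m) (+ 1) (+ 1) (θ⟨ m ⟩ a) (shift (prefix a)) k ⟨
    prefix^ (suc m) (λ k → + 1 * θ⟨ m ⟩ a k + + 1 * shift (prefix a) k) k
      ≡⟨ prefix^-cong (suc m) (λ k → lemma₃ (+ m) (θ a k) (shift (prefix a) k)) k ⟩
    prefix^ (suc m) (θ⟨ suc m ⟩ a) k ∎
    where
    open ≡-Reasoning
    lemma₁ : prefix^ (suc m) (shift (prefix a)) k ≡ shift (prefix (prefix (prefix^ m a))) k
    lemma₁ = trans (prefix^-shift (suc m) (prefix a) k) (shift-cong (prefix-cong (prefix^-prefix m a)) k)
    lemma₂ : ∀ x y → x + y ≡ + 1 * x + + 1 * y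
    lemma₂ = solve-∀
    lemma₃ : ∀ m x y → + 1 * (x + m * y) + + 1 * y ≡ x + (+ 1 + m) * y
    lemma₃ = solve-∀

  module _ (m : ℕ) where

    private
      n : ℕ
      n = suc m

      M N : ℤ
      M = + m
      N = + n

    term₁ : Seq → Seq
    term₁ b k = (+ 2 * + k + + 1) * b k + (+ 2 * N - + 2 * + k + + 1) * shift b k

    term₂ : Seq → Seq
    term₂ c k = (N - + 1 + + 2 * + k * (+ k + + 1)) * c k
                + (+ 2 * (N - + 1) + + 4 * (N - + k - + 1) * (+ k - + 1)) * shift c k
                + ((+ 2 * N - + 3) * (N - + 1) + + 2 * (+ k - + 2) * (+ k - + 2 * N + + 1)) * shift (shift c) k

    private
      -- The operator 2θ + 1, which multiplies the `r`-th value by `2 r + 1`, conjugated by (1 -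
      -- t)^n. It has the denominator 1 - t, and one difference clears it.
      U : Seq → Seq
      U b k = + 2 * θ⟨ n ⟩ b k + + 1 * b k

      -- The operator `m` + 2θ + 2θ² conjugated by (1 - t)^m. The square of `θ⟨ m ⟩` has the
      -- denominator (1 - t)², so two differences are taken.
      V₀ V : Seq → Seq
      V₀ c k = + 2 * θ⟨ m ⟩ (θ⟨ m ⟩ c) k + + 2 * θ⟨ m ⟩ c k
      V c k = + 1 * V₀ c k + M * c k

      ΔU : ∀ b → difference (U b) ≗ term₁ b
      ΔU b zero = lemma N (b 0)
        where
        lemma : ∀ N x → + 2 * (+ 0 * x + N * + 0) + + 1 * x - + 0 ≡
                        (+ 2 * + 0 + + 1) * x + (+ 2 * N - + 2 * + 0 + + 1) * + 0
        lemma = solve-∀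
      ΔU b (suc k) = trans (cong (λ s → + 2 * ((+ 1 + + k) * b (suc k) + N * s) + + 1 * b (suc k) - U b k) (prefix-unfold b k))
                           (lemma N (+ k) (b (suc k)) (b k) (shift (prefix b) k))
        where
        lemma : ∀ N k x y s → + 2 * ((+ 1 + k) * x + N * (y + s)) + + 1 * x - (+ 2 * (k * y + N * s) + + 1 * y) ≡
                        (+ 2 * (+ 1 + k) + + 1) * x + (+ 2 * N - + 2 * (+ 1 + k) + + 1) * y
        lemma = solve-∀

      ΔΔV : ∀ c → difference (difference (V c)) ≗ term₂ c
      ΔΔV c zero = lemma M (c 0)
        where
        lemma : ∀ M x → + 1 * (+ 2 * (+ 0 * (+ 0 * x + M * + 0) + M * + 0) + + 2 * (+ 0 * x + M * + 0)) + M * x - + 0 - + 0 ≡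
                ((+ 1 + M) - + 1 + + 2 * + 0 * (+ 0 + + 1)) * x
                + (+ 2 * ((+ 1 + M) - + 1) + + 4 * ((+ 1 + M) - + 0 - + 1) * (+ 0 - + 1)) * + 0
                + ((+ 2 * (+ 1 + M) - + 3) * ((+ 1 + M) - + 1) + + 2 * (+ 0 - + 2) * (+ 0 - + 2 * (+ 1 + M) + + 1)) * + 0
        lemma = solve-∀
      ΔΔV c (suc zero) = lemma M (c 0) (c 1)
        where
        lemma : ∀ M x y →
                (+ 1 * (+ 2 * (+ 1 * (+ 1 * y + M * x) + M * (+ 0 * x + M * + 0)) + + 2 * (+ 1 * y + M * x)) + M * y
                  - (+ 1 * (+ 2 * (+ 0 * (+ 0 * x + M * + 0) + M * + 0) + + 2 * (+ 0 * x + M * + 0)) + M * x))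
                - (+ 1 * (+ 2 * (+ 0 * (+ 0 * x + M * + 0) + M * + 0) + + 2 * (+ 0 * x + M * + 0)) + M * x - + 0) ≡
                ((+ 1 + M) - + 1 + + 2 * + 1 * (+ 1 + + 1)) * y
                + (+ 2 * ((+ 1 + M) - + 1) + + 4 * ((+ 1 + M) - + 1 - + 1) * (+ 1 - + 1)) * x
                + ((+ 2 * (+ 1 + M) - + 3) * ((+ 1 + M) - + 1) + + 2 * (+ 1 - + 2) * (+ 1 - + 2 * (+ 1 + M) + + 1)) * + 0
        lemma = solve-∀
      ΔΔV c (suc (suc k)) = go (prefix-unfold c k) (prefix-unfold (θ⟨ m ⟩ c) k)
        where
        -- `s` and `t` are the prefix sums of `c` and of `θ⟨ m ⟩ c` below `k`. The second difference
        -- cancels them and leaves three consecutive coefficients of `c`.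
        lemma : ∀ M k c₂ c₁ c₀ s t →
          let k₁ = + 1 + k
              k₂ = + 2 + k
              s₁ = c₀ + s
              s₂ = c₁ + s₁
              a₀ = k * c₀ + M * s
              a₁ = k₁ * c₁ + M * s₁
              a₂ = k₂ * c₂ + M * s₂
              t₁ = a₀ + t
              t₂ = a₁ + t₁
              v₀ = + 1 * (+ 2 * (k * a₀ + M * t) + + 2 * a₀) + M * c₀
              v₁ = + 1 * (+ 2 * (k₁ * a₁ + M * t₁) + + 2 * a₁) + M * c₁
              v₂ = + 1 * (+ 2 * (k₂ * a₂ + M * t₂) + + 2 * a₂) + M * c₂
              N  = + 1 + M
          in v₂ - v₁ - (v₁ - v₀) ≡
             (N - + 1 + + 2 * k₂ * (k₂ + + 1)) * c₂
                + (+ 2 * (N - + 1) + + 4 * (N - k₂ - + 1) * (k₂ - + 1)) * c₁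
                + ((+ 2 * N - + 3) * (N - + 1) + + 2 * (k₂ - + 2) * (k₂ - + 2 * N + + 1)) * c₀
        lemma = solve-∀

        go : ∀ {s₁ t₁} → s₁ ≡ c k + shift (prefix c) k → t₁ ≡ θ⟨ m ⟩ c k + shift (prefix (θ⟨ m ⟩ c)) k →
             let k₁ = + 1 + + k
                 k₂ = + 2 + + k
                 s₂ = c (suc k) + s₁
                 a₁ = k₁ * c (suc k) + M * s₁
                 a₂ = k₂ * c (suc (suc k)) + M * s₂
                 t₂ = a₁ + t₁
                 v₁ = + 1 * (+ 2 * (k₁ * a₁ + M * t₁) + + 2 * a₁) + M * c (suc k)
                 v₂ = + 1 * (+ 2 * (k₂ * a₂ + M * t₂) + + 2 * a₂) + M * c (suc (suc k))
             in v₂ - v₁ - (v₁ - V c k) ≡ term₂ c (suc (suc k))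
        go refl refl = lemma M (+ k) (c (suc (suc k))) (c (suc k)) (c k) (shift (prefix c) k) (shift (prefix (θ⟨ m ⟩ c)) k)

      prefix-term₁ : ∀ b → prefix (term₁ b) ≗ U b
      prefix-term₁ b k = trans (prefix-cong (λ j → sym (ΔU b j)) k) (prefix-difference (U b) k)

      prefix-term₂ : ∀ c → prefix (prefix (term₂ c)) ≗ V c
      prefix-term₂ c k = trans (prefix-cong (λ j → trans (prefix-cong (λ i → sym (ΔΔV c i)) j)
        (prefix-difference (difference (V c)) j)) k) (prefix-difference (V c) k)

      prefix^-term₁ : ∀ b k → prefix^ (suc n) (term₁ b) k ≡ (+ 2 * + k + + 1) * prefix^ n b k
      prefix^-term₁ b k = begin
        prefix^ (suc n) (term₁ b) k                            ≡⟨ prefix^-prefix n (term₁ b) k ⟨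
        prefix^ n (prefix (term₁ b)) k                         ≡⟨ prefix^-cong n (prefix-term₁ b) k ⟩
        prefix^ n (U b) k                                      ≡⟨ prefix^-linear n (+ 2) (+ 1) (θ⟨ n ⟩ b) b k ⟩
        + 2 * prefix^ n (θ⟨ n ⟩ b) k + + 1 * prefix^ n b k     ≡⟨ cong (λ x → + 2 * x + + 1 * prefix^ n b k) (θ-prefix^ n b k) ⟨
        + 2 * (+ k * prefix^ n b k) + + 1 * prefix^ n b k      ≡⟨ lemma (+ k) (prefix^ n b k) ⟩
        (+ 2 * + k + + 1) * prefix^ n b k                      ∎
        where
        open ≡-Reasoning
        lemma : ∀ k x → + 2 * (k * x) + + 1 * x ≡ (+ 2 * k + + 1) * x
        lemma = solve-∀

      prefix^-term₂ : ∀ c k → prefix^ (suc n) (term₂ c) k ≡ (M + + 2 * + k + + 2 * (+ k * + k)) * prefix^ m c k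
      prefix^-term₂ c k = begin
        prefix^ (suc n) (term₂ c) k
          ≡⟨ trans (prefix^-prefix m (prefix (term₂ c)) k) (prefix-cong (prefix^-prefix m (term₂ c)) k) ⟨
        prefix^ m (prefix (prefix (term₂ c))) k                ≡⟨ prefix^-cong m (prefix-term₂ c) k ⟩
        prefix^ m (V c) k                                      ≡⟨ prefix^-linear m (+ 1) M (V₀ c) c k ⟩
        + 1 * prefix^ m (V₀ c) k + M * P                       ≡⟨ cong (λ x → + 1 * x + M * P) (prefix^-linear m (+ 2) (+ 2) (θ⟨ m ⟩ (θ⟨ m ⟩ c)) (θ⟨ m ⟩ c) k) ⟩
        + 1 * (+ 2 * prefix^ m (θ⟨ m ⟩ (θ⟨ m ⟩ c)) k + + 2 * prefix^ m (θ⟨ m ⟩ c) k) + M * P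
          ≡⟨ cong (λ x → + 1 * (+ 2 * x + + 2 * prefix^ m (θ⟨ m ⟩ c) k) + M * P) (θ-prefix^ m (θ⟨ m ⟩ c) k) ⟨
        + 1 * (+ 2 * (+ k * prefix^ m (θ⟨ m ⟩ c) k) + + 2 * prefix^ m (θ⟨ m ⟩ c) k) + M * P
          ≡⟨ cong (λ x → + 1 * (+ 2 * (+ k * x) + + 2 * x) + M * P) (θ-prefix^ m c k) ⟨
        + 1 * (+ 2 * (+ k * (+ k * P)) + + 2 * (+ k * P)) + M * P
          ≡⟨ lemma M (+ k) P ⟩
        (M + + 2 * + k + + 2 * (+ k * + k)) * P ∎
        where
        open ≡-Reasoning
        P = prefix^ m c k
        lemma : ∀ M k x → + 1 * (+ 2 * (k * (k * x)) + + 2 * (k * x)) + M * x ≡ (M + + 2 * k + + 2 * (k * k)) * x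
        lemma = solve-∀

    -- After `suc n` prefix sums both sides of the conclusion become the two sides of the
    -- hypothesis. The different exponents of `prefix^` are absorbed by the differences in `term₁`
    -- and `term₂`.
    prefix^-recurrence : ∀ {a b c : Seq} →
      (∀ k → N * prefix^ (suc n) a k ≡
             (+ 2 * + k + + 1) * prefix^ n b k + (M + + 2 * + k + + 2 * (+ k * + k)) * prefix^ m c k) →
      ∀ k → N * a k ≡ term₁ b k + term₂ c k
    prefix^-recurrence {a} {b} {c} h k = begin
      N * a k                              ≡⟨ lemma₁ (N * a k) (a k) ⟩
      -- The zero summand gives the left side the two-term shape of `prefix^-linear`.
      N * a k + + 0 * a k                  ≡⟨ prefix^-injective (suc n) eq k ⟩
      + 1 * term₁ b k + + 1 * term₂ c k    ≡⟨ lemma₂ (term₁ b k) (term₂ c k) ⟩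
      term₁ b k + term₂ c k                ∎
      where
      open ≡-Reasoning
      lemma₁ : ∀ x y → x ≡ x + + 0 * y
      lemma₁ = solve-∀
      lemma₂ : ∀ x y → + 1 * x + + 1 * y ≡ x + y
      lemma₂ = solve-∀

      eq : prefix^ (suc n) (λ k → N * a k + + 0 * a k) ≗ prefix^ (suc n) (λ k → + 1 * term₁ b k + + 1 * term₂ c k)
      eq k = begin
        prefix^ (suc n) (λ k → N * a k + + 0 * a k) k            ≡⟨ prefix^-linear (suc n) N (+ 0) a a k ⟩
        N * prefix^ (suc n) a k + + 0 * prefix^ (suc n) a k      ≡⟨ lemma₁ (N * prefix^ (suc n) a k) (prefix^ (suc n) a k) ⟨
        N * prefix^ (suc n) a k                                  ≡⟨ h k ⟩
        (+ 2 * + k + + 1) * prefix^ n b k + (M + + 2 * + k + + 2 * (+ k * + k)) * prefix^ m c k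
          ≡⟨ cong₂ _+_ (prefix^-term₁ b k) (prefix^-term₂ c k) ⟨
        prefix^ (suc n) (term₁ b) k + prefix^ (suc n) (term₂ c) k
          ≡⟨ lemma₂ (prefix^ (suc n) (term₁ b) k) (prefix^ (suc n) (term₂ c) k) ⟨
        + 1 * prefix^ (suc n) (term₁ b) k + + 1 * prefix^ (suc n) (term₂ c) k
          ≡⟨ prefix^-linear (suc n) (+ 1) (+ 1) (term₁ b) (term₂ c) k ⟨
        prefix^ (suc n) (λ k → + 1 * term₁ b k + + 1 * term₂ c k) k ∎

-- Signed involutions as words of signs and indices.

module InvolutionWords where

  open Positions
  open ColouredWords
  open import Data.Nat.Properties

  same-length : ∀ {A : Set} {xs ys : List A} → Unique xs → Unique ys →
                (∀ {x} → x ∈ xs → x ∈ ys) → (∀ {x} → x ∈ ys → x ∈ xs) → length xs ≡ length ys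
  same-length u v f g = ↭-length (∼bag⇒↭ (unique∧set⇒bag u v (mk⇔ f g)))

  -- `g` recovers from an element the block it lies in, so distinct blocks are disjoint.
  unique-concatMap : ∀ {A B : Set} (f : A → List B) (g : B → A) {xs} → (∀ {x y} → y ∈ f x → g y ≡ x) →
                     (∀ x → Unique (f x)) → Unique xs → Unique (concatMap f xs)
  unique-concatMap f g inv u []                        = []
  unique-concatMap f g {x ∷ xs} inv u (p ∷ ps) = Uniqueₚ.++⁺ (u x) (unique-concatMap f g inv u ps) disj
    where
    disj : ∀ {y} → ¬ (y ∈ f x × y ∈ concatMap f xs)
    disj (y∈ , y∈′) with find (∈-concatMap⁻ f {xs = xs} y∈′)
    ... | x′ , x′∈ , y∈″ = All.lookup p x′∈ (trans (sym (inv y∈)) (inv y∈″))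

  Value : Set
  Value = Sign × ℕ

  toℤ : Value → ℤ
  toℤ (⊕ , m) = + suc m
  toℤ (⊖ , m) = -[1+ m ]

  toℤ-injective : ∀ {v w} → toℤ v ≡ toℤ w → v ≡ w
  toℤ-injective {⊕ , m} {⊕ , n} refl = refl
  toℤ-injective {⊖ , m} {⊖ , n} refl = refl
  toℤ-injective {⊕ , m} {⊖ , n} ()
  toℤ-injective {⊖ , m} {⊕ , n} ()

  ≼⇒≤ : ∀ {v w} → v ≼ w → toℤ v ℤ.≤ toℤ w
  ≼⇒≤ (⊖≼⊖ p) = -≤- p
  ≼⇒≤ ⊖≼⊕     = -≤+
  ≼⇒≤ (⊕≼⊕ p) = +≤+ (s≤s p)

  ≤⇒≼ : ∀ v w → toℤ v ℤ.≤ toℤ w → v ≼ w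
  ≤⇒≼ (⊖ , m) (⊖ , n) (-≤- p)       = ⊖≼⊖ p
  ≤⇒≼ (⊖ , m) (⊕ , n) -≤+           = ⊖≼⊕
  ≤⇒≼ (⊕ , m) (⊕ , n) (+≤+ (s≤s p)) = ⊕≼⊕ p

  values : ℕ → List Value
  values n = concatMap (λ j → (⊕ , j) ∷ (⊖ , j) ∷ []) (upTo n)

  valueWords : ℕ → ℕ → List (List Value)
  valueWords n zero    = [] ∷ []
  valueWords n (suc m) = concatMap (λ w → map (_∷ w) (values n)) (valueWords n m)

  candidates≡ : ∀ n → candidates n ≡ map toℤ (values n)
  candidates≡ n = begin
    concatMap (λ j → + j ∷ ℤ.- (+ j) ∷ []) (map suc (upTo n))   ≡⟨ concatMap-map _ suc (upTo n) ⟩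
    concatMap (λ j → + suc j ∷ -[1+ j ] ∷ []) (upTo n)           ≡⟨ map-concatMap toℤ _ (upTo n) ⟨
    map toℤ (values n)                                           ∎
    where open ≡-Reasoning

  words≡ : ∀ n m → words n m ≡ map (map toℤ) (valueWords n m)
  words≡ n zero    = refl
  words≡ n (suc m) = begin
    concatMap (λ w → map (_∷ w) (candidates n)) (words n m)
      ≡⟨ cong (concatMap _) (words≡ n m) ⟩
    concatMap (λ w → map (_∷ w) (candidates n)) (map (map toℤ) (valueWords n m))
      ≡⟨ concatMap-map _ (map toℤ) (valueWords n m) ⟩
    concatMap (λ w → map (_∷ map toℤ w) (candidates n)) (valueWords n m)
      ≡⟨ concatMap-cong (λ w → trans (cong (map _) (candidates≡ n)) (trans (sym (map-∘ (values n))) (map-∘ (values n))))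
           (valueWords n m) ⟩
    concatMap (λ w → map (map toℤ) (map (_∷ w) (values n))) (valueWords n m)
      ≡⟨ map-concatMap (map toℤ) _ (valueWords n m) ⟨
    map (map toℤ) (valueWords n (suc m)) ∎
    where open ≡-Reasoning

  ∈-values⁺ : ∀ {n s m} → m < n → (s , m) ∈ values n
  ∈-values⁺ {s = ⊕} m<n = ∈-concatMap⁺ _ (lose (∈-upTo⁺ m<n) (here refl))
  ∈-values⁺ {s = ⊖} m<n = ∈-concatMap⁺ _ (lose (∈-upTo⁺ m<n) (there (here refl)))

  values-unique : ∀ n → Unique (values n)
  values-unique n = unique-concatMap _ proj₂ (λ { (here refl) → refl ; (there (here refl)) → refl ; (there (there ())) })
    (λ j → ((λ ()) ∷ []) ∷ [] ∷ []) (Uniqueₚ.upTo⁺ n)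

  ∈-valueWords⁺ : ∀ {n} w → (∀ {i s m} → At w i (s , m) → m < n) → w ∈ valueWords n (length w)
  ∈-valueWords⁺ []      h = here refl
  ∈-valueWords⁺ (v ∷ w) h = ∈-concatMap⁺ _ (lose (∈-valueWords⁺ w (h ∘ there)) (∈-map⁺ (_∷ w) (∈-values⁺ (h here))))

  ∈-valueWords⁻ : ∀ {n} m {w} → w ∈ valueWords n m → length w ≡ m
  ∈-valueWords⁻ zero (here refl) = refl
  ∈-valueWords⁻ {n} (suc m) w∈ with find (∈-concatMap⁻ (λ w → map (_∷ w) (values n)) {xs = valueWords n m} w∈)
  ... | w′ , w′∈ , w∈′ with ∈-map⁻ (_∷ w′) w∈′
  ...   | v , v∈ , refl = cong suc (∈-valueWords⁻ m w′∈)

  valueWords-unique : ∀ n m → Unique (valueWords n m)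
  valueWords-unique n zero    = [] ∷ []
  valueWords-unique n (suc m) = unique-concatMap _ (drop 1)
    (λ {w} v∷w∈ → tail-∈ w v∷w∈)
    (λ w → Uniqueₚ.map⁺ ∷-injectiveˡ (values-unique n)) (valueWords-unique n m)
    where
    tail-∈ : ∀ w {w′} → w′ ∈ map (_∷ w) (values n) → drop 1 w′ ≡ w
    tail-∈ w w′∈ with ∈-map⁻ (_∷ w) w′∈
    ... | v , v∈ , refl = refl

  InvolutiveWord : List Value → Set
  InvolutiveWord w = ∀ {i s m} → At w i (s , m) → At w m (s , i)

  at-At : ∀ {w i v} → At w i v → at (map toℤ w) (suc i) ≡ toℤ v
  at-At here              = refl
  at-At (there {i = i} p) = at-At p

  -- Out of range `at` returns 0, and `toℤ` never takes the value 0, so the equation itself shows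
  -- that the position exists.
  At-at : ∀ w i {v} → at (map toℤ w) (suc i) ≡ toℤ v → At w i v
  At-at []      i       {⊕ , m} ()
  At-at []      i       {⊖ , m} ()
  At-at (x ∷ w) zero    eq with toℤ-injective eq
  ... | refl = here
  At-at (x ∷ w) (suc i) eq = there (At-at w i eq)

  ∣toℤ∣ : ∀ s m → ∣ toℤ (s , m) ∣ ≡ suc m
  ∣toℤ∣ ⊕ m = refl
  ∣toℤ∣ ⊖ m = refl

  sgnMul-toℤ : ∀ s m i → sgnMul (toℤ (s , m)) (suc i) ≡ toℤ (s , i)
  sgnMul-toℤ ⊕ m i = refl
  sgnMul-toℤ ⊖ m i = refl

  private
    InvAt : List ℤ → ℕ → Set
    InvAt π i = at π ∣ at π i ∣ ≡ sgnMul (at π i) i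

    invAt : ∀ w {i s m} → At w i (s , m) →
            InvAt (map toℤ w) (suc i) ≡ (at (map toℤ w) (suc m) ≡ toℤ (s , i))
    invAt w {i} {s} {m} p = begin
      at π ∣ at π (suc i) ∣ ≡ sgnMul (at π (suc i)) (suc i)
        ≡⟨ cong (λ x → at π ∣ x ∣ ≡ sgnMul x (suc i)) (at-At p) ⟩
      at π ∣ toℤ (s , m) ∣ ≡ sgnMul (toℤ (s , m)) (suc i)
        ≡⟨ cong₂ (λ x y → at π x ≡ y) (∣toℤ∣ s m) (sgnMul-toℤ s m i) ⟩
      at π (suc m) ≡ toℤ (s , i) ∎
      where
      open ≡-Reasoning
      π = map toℤ w

  isInvolution⁻ : ∀ w → T (isInvolution (map toℤ w)) → InvolutiveWord w
  isInvolution⁻ w t {i} {s} {m} p = At-at w m (subst (λ A → A) (invAt w p) (toWitness (All.lookup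
    (all⁺ _ (oneTo (length π)) t) (∈-map⁺ suc (∈-upTo⁺ (subst (i <_) (sym (length-map toℤ w)) (At-< p)))))))
    where π = map toℤ w

  isInvolution⁺ : ∀ w → InvolutiveWord w → T (isInvolution (map toℤ w))
  isInvolution⁺ w inv = all⁻ _ (All.tabulate ok)
    where
    π = map toℤ w
    ok : ∀ {k} → k ∈ oneTo (length π) → T ⌊ at π ∣ at π k ∣ ℤ.≟ sgnMul (at π k) k ⌋
    ok k∈ with ∈-map⁻ suc k∈
    ... | i , i∈ , refl with At-total w (subst (i <_) (length-map toℤ w) (∈-upTo⁻ i∈))
    ...   | (s , m) , p = fromWitness (subst (λ A → A) (sym (invAt w p)) (at-At (inv p)))

  any-false : ∀ {A : Set} (p : A → Bool) xs → (∀ {i x} → At xs i x → p x ≡ false) → any p xs ≡ false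
  any-false p []       h = refl
  any-false p (x ∷ xs) h = cong₂ _∨_ (h here) (any-false p xs (h ∘ there))

  distinct⁺ : ∀ xs → (∀ {i j x} → At xs i x → At xs j x → i ≡ j) → distinctℕ xs ≡ true
  distinct⁺ []       h = refl
  distinct⁺ (x ∷ xs) h = cong₂ _∧_ (cong not (any-false _ xs fresh))
    (distinct⁺ xs (λ p q → suc-injective (h (there p) (there q))))
    where
    fresh : ∀ {i y} → At xs i y → ⌊ x ℕ.≟ y ⌋ ≡ false
    fresh {y = y} p with x ℕ.≟ y
    ... | no _ = refl
    ... | yes refl with h here (there p)
    ...   | ()

  -- Two positions of absolute value `m + 1` are both the index stored at position `m`.
  isSignedPerm⁺ : ∀ w → InvolutiveWord w → isSignedPerm (map toℤ w) ≡ true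
  isSignedPerm⁺ w inv = distinct⁺ _ injective
    where
    injective : ∀ {i j x} → At (map ∣_∣ (map toℤ w)) i x → At (map ∣_∣ (map toℤ w)) j x → i ≡ j
    injective p q with At-map⁻ ∣_∣ (map toℤ w) p | At-map⁻ ∣_∣ (map toℤ w) q
    ... | _ , eq₁ , p′ | _ , eq₂ , q′ with At-map⁻ toℤ w p′ | At-map⁻ toℤ w q′
    ... | (s , m) , refl , p″ | (t , k) , refl , q″
      with suc-injective (trans (sym (∣toℤ∣ s m)) (trans (sym eq₁) (trans eq₂ (∣toℤ∣ t k))))
    ... | refl = cong proj₂ (At-functional (inv p″) (inv q″))

  involutions : ℕ → List (List Value)
  involutions n = filterᵇ (λ w → isInvolution (map toℤ w)) (valueWords n n)

  ∈-involutions⁻ : ∀ {n w} → w ∈ involutions n → length w ≡ n × InvolutiveWord w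
  ∈-involutions⁻ {n} {w} w∈ with ∈-filter⁻ (T? ∘ (λ w → isInvolution (map toℤ w))) {xs = valueWords n n} w∈
  ... | w∈′ , t = ∈-valueWords⁻ n w∈′ , isInvolution⁻ w t

  ∈-involutions⁺ : ∀ w → InvolutiveWord w → w ∈ involutions (length w)
  ∈-involutions⁺ w inv = ∈-filter⁺ (T? ∘ (λ w → isInvolution (map toℤ w)))
    (∈-valueWords⁺ w (λ p → At-< (inv p))) (isInvolution⁺ w inv)

  involutions-unique : ∀ n → Unique (involutions n)
  involutions-unique n = Uniqueₚ.filter⁺ (T? ∘ (λ w → isInvolution (map toℤ w))) (valueWords-unique n n)

  descending : ℕ → List (List Value) → ℕ
  descending k ws = length (filterᵇ (λ w → ⌊ + desB (map toℤ w) ℤ.≟ + k ⌋) ws)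

  IB≡descending : ∀ n k → IB n (+ k) ≡ descending k (involutions n)
  IB≡descending n k = trans (cong (λ ws → length (filterᵇ _ (filterᵇ isSignedPerm ws))) (words≡ n n))
                            (go (valueWords n n))
    where
    go : ∀ ws → length (filterᵇ (λ π → isInvolution π ∧ ⌊ + desB π ℤ.≟ + k ⌋) (filterᵇ isSignedPerm (map (map toℤ) ws)))
              ≡ descending k (filterᵇ (λ w → isInvolution (map toℤ w)) ws)
    go []       = refl
    go (w ∷ ws) with isInvolution (map toℤ w) in eqᵢ | isSignedPerm (map toℤ w) in eqₛ
    ... | true  | false with trans (sym eqₛ) (isSignedPerm⁺ w (isInvolution⁻ w (subst T (sym eqᵢ) tt)))
    ...   | ()
    go (w ∷ ws) | false | false = go ws
    go (w ∷ ws) | false | true rewrite eqᵢ = go ws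
    go (w ∷ ws) | true  | true rewrite eqᵢ with ⌊ + desB (map toℤ w) ℤ.≟ + k ⌋
    ... | true  = cong suc (go ws)
    ... | false = go ws

-- Colourings of involutions and their count.

module Colourings where

  open Positions
  open ColouredWords
  open Valid
  open Peeling
  open ProductSeries
  open Alphabet
  open PrefixSums
  open InvolutionWords
  open import Data.Nat using (_+_)
  open import Data.Nat.Properties

  -- v and a are the value and the colour preceding the word; the colours used lie in [a , a + m].
  mutual
    colourings : Value → List Value → ℕ → ℕ → List (List Entry)
    colourings v []      a m = [] ∷ []
    colourings v (w ∷ ws) a m = descend (⌊ toℤ w ℤ.<? toℤ v ⌋) w ws a m

    descend : Bool → Value → List Value → ℕ → ℕ → List (List Entry)
    descend false w ws a m       = headed w ws a m
    descend true  w ws a zero    = []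
    descend true  w ws a (suc m) = headed w ws (suc a) m

    headed : Value → List Value → ℕ → ℕ → List (List Entry)
    headed w ws a zero    = map ((a , w) ∷_) (colourings w ws a zero)
    headed w ws a (suc m) = map ((a , w) ∷_) (colourings w ws a (suc m)) ++ headed w ws (suc a) m

  Coloured : Value → List Value → ℕ → ℕ → List Entry → Set
  Coloured v ws a b q = map proj₂ q ≡ ws × Sorted ((a , v) ∷ q) × (∀ {i e} → At q i e → colour e ≤ b)

  HeadColoured : Value → List Value → ℕ → ℕ → List Entry → Set
  HeadColoured w ws a b q = ∃₂ λ c q′ → q ≡ (c , w) ∷ q′ × a ≤ c × c ≤ b × Coloured w ws c b q′

  sorted-∷ : ∀ {d e q} → d ⊑ e → Sorted (e ∷ q) → Sorted (d ∷ e ∷ q)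
  sorted-∷ d⊑e so {zero}  {suc zero}    _         here      (there here)      = d⊑e
  sorted-∷ d⊑e so {zero}  {suc (suc j)} _         here      (there (there p)) =
    ⊑-trans d⊑e (so (s≤s z≤n) here (there p))
  sorted-∷ d⊑e so {suc i} {suc j}       (s≤s i<j) (there p) (there p′)        = so i<j p p′

  sorted-singleton : ∀ {e} → Sorted (e ∷ [])
  sorted-singleton {i = zero}  {zero}  () here here
  sorted-singleton {i = suc i}         _  (there ())
  sorted-singleton {i = zero}  {suc j} _  here (there ())

  mutual
    colourings-sound : ∀ v ws a m {q} → q ∈ colourings v ws a m → Coloured v ws a (a + m) q
    colourings-sound v []       a m (here refl) = refl , sorted-singleton , λ ()
    colourings-sound v (w ∷ ws) a m q∈ = go (toℤ w ℤ.<? toℤ v) m q∈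
      where
      cons : ∀ {q b d} → (∀ {c} → d ≤ c → (a , v) ⊑ (c , w)) → HeadColoured w ws d b q → Coloured v (w ∷ ws) a b q
      cons h (c , q′ , refl , d≤c , c≤b , refl , so , bd) =
        refl , sorted-∷ (h d≤c) so , λ { here → c≤b ; (there p) → bd p }

      go : ∀ {q} (d : Dec (toℤ w ℤ.< toℤ v)) m → q ∈ descend ⌊ d ⌋ w ws a m → Coloured v (w ∷ ws) a (a + m) q
      go {q} (yes _) (suc m) q∈ = subst (λ b → Coloured v (w ∷ ws) a b q) (sym (+-suc a m))
        (cons colour< (headed-sound w ws (suc a) m q∈))
      go (no w≮v) m q∈ = cons weak (headed-sound w ws a m q∈)
        where
        weak : ∀ {c} → a ≤ c → (a , v) ⊑ (c , w)
        weak a≤c with m≤n⇒m<n∨m≡n a≤c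
        ... | inj₁ a<c  = colour< a<c
        ... | inj₂ refl = value≼ (≤⇒≼ v w (ℤₚ.≮⇒≥ w≮v))

    headed-sound : ∀ w ws a m {q} → q ∈ headed w ws a m → HeadColoured w ws a (a + m) q
    headed-sound w ws a zero q∈ with ∈-map⁻ ((a , w) ∷_) q∈
    ... | q′ , q′∈ , refl = a , q′ , refl , ≤-refl , m≤m+n a zero , colourings-sound w ws a zero q′∈
    headed-sound w ws a (suc m) {q} q∈ with ∈-++⁻ (map ((a , w) ∷_) (colourings w ws a (suc m))) q∈
    ... | inj₂ q∈′ with headed-sound w ws (suc a) m q∈′
    ...   | c , q′ , eq , a<c , rest = c , q′ , eq , <⇒≤ a<c ,
            subst (λ b → c ≤ b × Coloured w ws c b q′) (sym (+-suc a m)) rest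
    headed-sound w ws a (suc m) {q} q∈ | inj₁ q∈′ with ∈-map⁻ ((a , w) ∷_) q∈′
    ... | q′ , q′∈ , refl = a , q′ , refl , ≤-refl , m≤m+n a (suc m) , colourings-sound w ws a (suc m) q′∈

  mutual
    colourings-complete : ∀ v ws a m {q} → Coloured v ws a (a + m) q → q ∈ colourings v ws a m
    colourings-complete v []       a m {[]}           _            = here refl
    colourings-complete v []       a m {_ ∷ _}        (() , _)
    colourings-complete v (w ∷ ws) a m {[]}           (() , _)
    colourings-complete v (w ∷ ws) a m {(c , w′) ∷ q} (eq , so , bd) with ∷-injective eq
    ... | refl , eq′ = go (toℤ w ℤ.<? toℤ v) m (bd here) (λ p → bd (there p))
      where
      head : (a , v) ⊑ (c , w)
      head = so (s≤s z≤n) here (there here)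

      strict : toℤ w ℤ.< toℤ v → (a , v) ⊑ (c , w) → a < c
      strict w<v (colour< a<c) = a<c
      strict w<v (value≼ v≼w)  = ⊥-elim (ℤₚ.<⇒≱ w<v (≼⇒≤ v≼w))

      go : ∀ (d : Dec (toℤ w ℤ.< toℤ v)) m → c ≤ a + m → (∀ {i e} → At q i e → colour e ≤ a + m) →
           (c , w) ∷ q ∈ descend ⌊ d ⌋ w ws a m
      go (no w≮v)  m       c≤ bd = headed-complete w ws a m (c , q , refl , ⊑⇒colour≤ head , c≤ , eq′ , Sorted-tail so , bd)
      go (yes w<v) zero    c≤ bd = ⊥-elim (<⇒≱ (strict w<v head) (subst (c ≤_) (+-identityʳ a) c≤))
      go (yes w<v) (suc m) c≤ bd = headed-complete w ws (suc a) m
        (c , q , refl , strict w<v head , subst (c ≤_) (+-suc a m) c≤ , eq′ , Sorted-tail so ,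
         λ {i} {e} p → subst (colour e ≤_) (+-suc a m) (bd p))

    headed-complete : ∀ w ws a m {q} → HeadColoured w ws a (a + m) q → q ∈ headed w ws a m
    headed-complete w ws a zero (c , q , refl , a≤c , c≤ , col) with ≤-antisym (subst (c ≤_) (+-identityʳ a) c≤) a≤c
    ... | refl = ∈-map⁺ _ (colourings-complete w ws a zero col)
    headed-complete w ws a (suc m) (c , q , refl , a≤c , c≤ , col) with m≤n⇒m<n∨m≡n a≤c
    ... | inj₂ refl = ∈-++⁺ˡ (∈-map⁺ _ (colourings-complete w ws a (suc m) col))
    ... | inj₁ a<c  = ∈-++⁺ʳ _ (headed-complete w ws (suc a) m (c , q , refl , a<c ,
            subst (λ b → c ≤ b × Coloured w ws c b q) (+-suc a m) (c≤ , col)))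

  mutual
    colourings-unique : ∀ v ws a m → Unique (colourings v ws a m)
    colourings-unique v []       a m = [] ∷ []
    colourings-unique v (w ∷ ws) a m = go ⌊ toℤ w ℤ.<? toℤ v ⌋ m
      where
      go : ∀ d m → Unique (descend d w ws a m)
      go false m       = headed-unique w ws a m
      go true  zero    = []
      go true  (suc m) = headed-unique w ws (suc a) m

    headed-unique : ∀ w ws a m → Unique (headed w ws a m)
    headed-unique w ws a zero    = Uniqueₚ.map⁺ ∷-injectiveʳ (colourings-unique w ws a zero)
    headed-unique w ws a (suc m) = Uniqueₚ.++⁺ (Uniqueₚ.map⁺ ∷-injectiveʳ (colourings-unique w ws a (suc m)))
      (headed-unique w ws (suc a) m) disj
      where
      disj : ∀ {q} → ¬ (q ∈ map ((a , w) ∷_) (colourings w ws a (suc m)) × q ∈ headed w ws (suc a) m)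
      disj (q∈ , q∈′) with ∈-map⁻ ((a , w) ∷_) q∈ | headed-sound w ws (suc a) m q∈′
      ... | _ , _ , refl | _ , _ , refl , a<a , _ = <-irrefl refl a<a

  monomial : ℕ → Seq
  monomial zero    zero    = + 1
  monomial zero    (suc k) = + 0
  monomial (suc d)         = shift (monomial d)

  monomial-≡ : ∀ d → monomial d d ≡ + 1
  monomial-≡ zero    = refl
  monomial-≡ (suc d) = monomial-≡ d

  monomial-≢ : ∀ d k → ¬ d ≡ k → monomial d k ≡ + 0
  monomial-≢ zero    zero    d≢k = ⊥-elim (d≢k refl)
  monomial-≢ zero    (suc k) d≢k = refl
  monomial-≢ (suc d) zero    d≢k = refl
  monomial-≢ (suc d) (suc k) d≢k = monomial-≢ d k (λ eq → d≢k (cong suc eq))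

  -- In terms of the slack `m`, choosing the next colour is a prefix sum and a descent uses up one
  -- unit, a shift. The slack left at the end accounts for the extra prefix sum.
  count-colourings : ∀ v ws a m → + length (colourings v ws a m) ≡
                     prefix^ (suc (length ws)) (monomial (descents (map toℤ (v ∷ ws)))) m
  count-headed : ∀ w ws a m → + length (headed w ws a m) ≡
                 prefix^ (suc (suc (length ws))) (monomial (descents (map toℤ (w ∷ ws)))) m

  count-colourings v []       a m = lemma m
    where
    lemma : ∀ m → + 1 ≡ prefix (monomial 0) m
    lemma zero    = refl
    lemma (suc m) = trans (lemma m) (sym (ℤₚ.+-identityˡ (prefix (monomial 0) m)))
  count-colourings v (w ∷ ws) a m with ⌊ toℤ w ℤ.<? toℤ v ⌋
  ... | false = count-headed w ws a m
  ... | true  = trans (strict m) (sym (prefix^-shift (suc (suc (length ws))) (monomial (descents (map toℤ (w ∷ ws)))) m))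
    where
    strict : ∀ m → + length (descend true w ws a m) ≡
             shift (prefix^ (suc (suc (length ws))) (monomial (descents (map toℤ (w ∷ ws))))) m
    strict zero    = refl
    strict (suc m) = count-headed w ws (suc a) m

  count-headed w ws a zero    = trans (cong +_ (length-map _ (colourings w ws a zero))) (count-colourings w ws a zero)
  count-headed w ws a (suc m) = begin
    + length (map ((a , w) ∷_) (colourings w ws a (suc m)) ++ headed w ws (suc a) m)
      ≡⟨ trans (cong +_ (length-++ (map _ (colourings w ws a (suc m))))) (ℤₚ.pos-+ (length (map _ (colourings w ws a (suc m)))) _) ⟩
    + length (map ((a , w) ∷_) (colourings w ws a (suc m))) ℤ.+ + length (headed w ws (suc a) m)
      ≡⟨ cong₂ ℤ._+_ (trans (cong +_ (length-map _ (colourings w ws a (suc m)))) (count-colourings w ws a (suc m)))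
                     (count-headed w ws (suc a) m) ⟩
    prefix^ (suc (suc (length ws))) (monomial (descents (map toℤ (w ∷ ws)))) (suc m) ∎
    where open ≡-Reasoning

  colouredInvolutions : ℕ → ℕ → List (List Entry)
  colouredInvolutions n r = concatMap (λ w → colourings (⊕ , 0) w 0 r) (involutions n)

  -- Entries are nonzero integers, so lying below 1 and lying below 0 are the same.
  desB-descents : ∀ w → descents (map toℤ ((⊕ , 0) ∷ w)) ≡ desB (map toℤ w)
  desB-descents []            = refl
  desB-descents ((⊕ , m) ∷ w) = refl
  desB-descents ((⊖ , m) ∷ w) = refl

  private
    monomial-≟ : ∀ d k → monomial d k ≡ (if ⌊ + d ℤ.≟ + k ⌋ then + 1 else + 0)
    monomial-≟ d k = go (+ d ℤ.≟ + k)
      where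
      go : (x : Dec (+ d ≡ + k)) → monomial d k ≡ (if ⌊ x ⌋ then + 1 else + 0)
      go (yes refl) = monomial-≡ d
      go (no neq)   = monomial-≢ d k (λ eq → neq (cong +_ eq))

    descending-∷ : ∀ w ws k → + descending k (w ∷ ws) ≡ + 1 ℤ.* monomial (desB (map toℤ w)) k ℤ.+ + 1 ℤ.* + descending k ws
    descending-∷ w ws k rewrite monomial-≟ (desB (map toℤ w)) k | ℤₚ.*-identityˡ (+ descending k ws)
      with ⌊ + desB (map toℤ w) ℤ.≟ + k ⌋
    ... | true  = refl
    ... | false = sym (ℤₚ.+-identityˡ (+ descending k ws))

    prefix^-zero : ∀ m k → prefix^ m (λ _ → + 0) k ≡ + 0
    prefix^-zero zero    k = refl
    prefix^-zero (suc m) k = trans (prefix-cong (prefix^-zero m) k) (go k)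
      where
      go : ∀ k → prefix (λ _ → + 0) k ≡ + 0
      go zero    = refl
      go (suc k) = trans (ℤₚ.+-identityˡ _) (go k)

    count-words : ∀ n r ws → (∀ {w} → w ∈ ws → length w ≡ n) →
                  + length (concatMap (λ w → colourings (⊕ , 0) w 0 r) ws) ≡
                  prefix^ (suc n) (λ k → + descending k ws) r
    count-words n r []       len = sym (prefix^-zero (suc n) r)
    count-words n r (w ∷ ws) len = begin
      + length (colourings (⊕ , 0) w 0 r ++ concatMap _ ws)
        ≡⟨ trans (cong +_ (length-++ (colourings (⊕ , 0) w 0 r))) (ℤₚ.pos-+ (length (colourings (⊕ , 0) w 0 r)) _) ⟩
      + length (colourings (⊕ , 0) w 0 r) ℤ.+ + length (concatMap _ ws)
        ≡⟨ cong₂ ℤ._+_ first (count-words n r ws (λ w∈ → len (there w∈))) ⟩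
      P ℤ.+ Q
        ≡⟨ cong₂ ℤ._+_ (ℤₚ.*-identityˡ P) (ℤₚ.*-identityˡ Q) ⟨
      + 1 ℤ.* P ℤ.+ + 1 ℤ.* Q
        ≡⟨ prefix^-linear (suc n) (+ 1) (+ 1) (monomial (desB (map toℤ w))) (λ k → + descending k ws) r ⟨
      prefix^ (suc n) (λ k → + 1 ℤ.* monomial (desB (map toℤ w)) k ℤ.+ + 1 ℤ.* + descending k ws) r
        ≡⟨ prefix^-cong (suc n) (descending-∷ w ws) r ⟨
      prefix^ (suc n) (λ k → + descending k (w ∷ ws)) r ∎
      where
      open ≡-Reasoning
      P = prefix^ (suc n) (monomial (desB (map toℤ w))) r
      Q = prefix^ (suc n) (λ k → + descending k ws) r

      first : + length (colourings (⊕ , 0) w 0 r) ≡ P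
      first = trans (count-colourings (⊕ , 0) w 0 r)
        (cong₂ (λ l d → prefix^ (suc l) (monomial d) r) (len (here refl)) (desB-descents w))

  IBSeq : ℕ → Seq
  IBSeq n k = + IB n (+ k)

  count-colouredInvolutions : ∀ n r → + length (colouredInvolutions n r) ≡ prefix^ (suc n) (IBSeq n) r
  count-colouredInvolutions n r = trans
    (count-words n r (involutions n) (λ w∈ → proj₁ (∈-involutions⁻ w∈)))
    (prefix^-cong (suc n) (λ k → cong +_ (sym (IB≡descending n k))) r)

  colouredInvolutions-sound : ∀ {n r q} → q ∈ colouredInvolutions n r → Valid (alphabet r) n q
  colouredInvolutions-sound {n} {r} {q} q∈
    with find (∈-concatMap⁻ (λ w → colourings (⊕ , 0) w 0 r) {xs = involutions n} q∈)
  ... | w , w∈ , q∈′ with ∈-involutions⁻ w∈ | colourings-sound (⊕ , 0) w 0 r q∈′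
  ...   | len , inv | refl , so , bd = valid-alphabet⁺ (trans (sym (length-map proj₂ q)) len) (Sorted-tail so)
          (λ p → so (s≤s z≤n) here (there p)) involutive′ bd
    where
    involutive′ : Involutive q
    involutive′ p with At-map⁻ proj₂ q (inv (At-map proj₂ p))
    ... | (c , _) , refl , p′ = c , p′

  colouredInvolutions-complete : ∀ {n r q} → Valid (alphabet r) n q → q ∈ colouredInvolutions n r
  colouredInvolutions-complete {n} {r} {q} V =
    ∈-concatMap⁺ _ (lose (subst (λ k → map proj₂ q ∈ involutions k) len (∈-involutions⁺ (map proj₂ q) inv))
      (colourings-complete (⊕ , 0) (map proj₂ q) 0 r (refl , so , colour-≤ (alphabet-bound r) V)))
    where
    len : length (map proj₂ q) ≡ n
    len = trans (length-map proj₂ q) (length≡ V)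

    inv : InvolutiveWord (map proj₂ q)
    inv p with At-map⁻ proj₂ q p
    ... | _ , refl , p′ with involutive V p′
    ...   | c , p″ = At-map proj₂ p″

    so : Sorted (bottom ∷ q)
    so {zero}  {suc j} _         here      (there p)  = positive V p
    so {suc i} {suc j} (s≤s i<j) (there p) (there p′) = sorted V i<j p p′
    so {zero}  {zero}  ()

  colouredInvolutions-unique : ∀ n r → Unique (colouredInvolutions n r)
  colouredInvolutions-unique n r = unique-concatMap _ (map proj₂)
    (λ {w} q∈ → proj₁ (colourings-sound (⊕ , 0) w 0 r q∈))
    (λ w → colourings-unique (⊕ , 0) w 0 r) (involutions-unique n)

  -- The valid words over `alphabet r` are listed twice, letter by letter and as colourings of
  -- involutions. Duplicate-free lists with the same elements have equal length, so the product
  -- recurrence passes to the second count.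
  prefix^-IBSeq : ∀ r → Product (+ 2 ℤ.* + r ℤ.+ + 1) (+ r ℤ.* + r) (λ n → prefix^ (suc n) (IBSeq n) r)
  prefix^-IBSeq r = mkProduct
    (subst₂ (λ x y → x ≡ (+ 2 ℤ.* + r ℤ.+ + 1) ℤ.* y) (same 1) (same 0) (Product.one G))
    (λ n → trans (cong (λ x → + (2 + n) ℤ.* x) (sym (same (2 + n))))
      (trans (Product.step G n)
        (cong₂ (λ x y → (+ 2 ℤ.* + r ℤ.+ + 1) ℤ.* x ℤ.+ (+ n ℤ.+ (+ 2 ℤ.* + r ℤ.+ + 1) ℤ.+ + 2 ℤ.* (+ r ℤ.* + r)) ℤ.* y)
          (same (suc n)) (same n))))
    where
    C = counted-alphabet r
    G = Counted.product C

    same : ∀ n → + length (Counted.lists C n) ≡ prefix^ (suc n) (IBSeq n) r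
    same n = trans (cong +_ (same-length (Enumerates.unique E) (colouredInvolutions-unique n r)
        (λ q∈ → colouredInvolutions-complete (Enumerates.sound E q∈))
        (λ q∈ → Enumerates.complete E (colouredInvolutions-sound q∈))))
      (count-colouredInvolutions n r)
      where E = Counted.enumerates C n

-- The recurrence for the descent numbers.

open ProductSeries
open PrefixSums
open Colourings

open import Data.Integer using (_+_; _-_; _*_)
open import Data.Nat using (_≥_)

IB-negative : ∀ n k → IB n -[1+ k ] ≡ 0
IB-negative n k = go (signedPerms n)
  where
  go : ∀ πs → length (filterᵇ (λ π → isInvolution π ∧ ⌊ + desB π ℤ.≟ -[1+ k ] ⌋) πs) ≡ 0
  go []       = refl
  go (π ∷ πs) rewrite ∧-zeroʳ (isInvolution π) = go πs

-- The 0 that `shift` puts in front is the count at a negative number of descents.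
IB-shift : ∀ n k → + IB n (+ k - + 1) ≡ shift (IBSeq n) k
IB-shift n zero    = cong +_ (IB-negative n 0)
IB-shift n (suc k) = refl

IB-shift² : ∀ n k → + IB n (+ k - + 2) ≡ shift (shift (IBSeq n)) k
IB-shift² n zero          = cong +_ (IB-negative n 1)
IB-shift² n (suc zero)    = cong +_ (IB-negative n 0)
IB-shift² n (suc (suc k)) = refl

IBSeq-recurrence : ∀ ν k → + (2 ℕ.+ ν) * IBSeq (2 ℕ.+ ν) k ≡ term₁ (suc ν) (IBSeq (suc ν)) k + term₂ (suc ν) (IBSeq ν) k
IBSeq-recurrence ν = prefix^-recurrence (suc ν) {IBSeq (2 ℕ.+ ν)} {IBSeq (suc ν)} {IBSeq ν} λ r →
  trans (Product.step (prefix^-IBSeq r) ν)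
        (cong (λ x → (+ 2 * + r + + 1) * prefix^ (2 ℕ.+ ν) (IBSeq (suc ν)) r + x * prefix^ (suc ν) (IBSeq ν) r)
              (lemma (+ ν) (+ r)))
  where
  -- The coefficient `ν + p + 2 d` at `p = 2 r + 1` and `d = r²`, with `1 + ν` standing for `n - 1`.
  lemma : ∀ ν r → ν + (+ 2 * r + + 1) + + 2 * (r * r) ≡ (+ 1 + ν) + + 2 * r + + 2 * (r * r)
  lemma = solve-∀

theorem1p4 : (IB 1 (+ 0) ≡ 1) × (IB 1 (+ 1) ≡ 1) × (IB 2 (+ 0) ≡ 1) × (IB 2 (+ 1) ≡ 4) × (IB 2 (+ 2) ≡ 1)
    × ((n k : ℕ) → n ≥ 3 →
    let N = + n
        K = + k
    in N * + IB n K
    ≡ (+ 2 * K + + 1) * + IB (ℕ.pred n) K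
    + (+ 2 * N - + 2 * K + + 1) * + IB (ℕ.pred n) (K - + 1)
    + (N - + 1 + + 2 * K * (K + + 1)) * + IB (n ℕ.∸ 2) K
    + (+ 2 * (N - + 1) + + 4 * (N - K - + 1) * (K - + 1)) * + IB (n ℕ.∸ 2) (K - + 1)
    + ((+ 2 * N - + 3) * (N - + 1) + + 2 * (K - + 2) * (K - + 2 * N + + 1)) * + IB (n ℕ.∸ 2) (K - + 2))
theorem1p4 = refl , refl , refl , refl , refl , recurrence
  where
  reassociate : ∀ a b c d e → a + b + (c + d + e) ≡ a + b + c + d + e
  reassociate = solve-∀

  recurrence : (n k : ℕ) → n ≥ 3 →
    let N = + n
        K = + k
    in N * + IB n K
      ≡ (+ 2 * K + + 1) * + IB (ℕ.pred n) K
        + (+ 2 * N - + 2 * K + + 1) * + IB (ℕ.pred n) (K - + 1)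
        + (N - + 1 + + 2 * K * (K + + 1)) * + IB (n ℕ.∸ 2) K
        + (+ 2 * (N - + 1) + + 4 * (N - K - + 1) * (K - + 1)) * + IB (n ℕ.∸ 2) (K - + 1)
        + ((+ 2 * N - + 3) * (N - + 1) + + 2 * (K - + 2) * (K - + 2 * N + + 1)) * + IB (n ℕ.∸ 2) (K - + 2)
  recurrence zero          k ()
  recurrence (suc zero)    k (s≤s ())
  recurrence (suc (suc ν)) k _ = begin
    N * IBSeq (2 ℕ.+ ν) k
      ≡⟨ IBSeq-recurrence ν k ⟩
    term₁ (suc ν) (IBSeq (suc ν)) k + term₂ (suc ν) (IBSeq ν) k
      ≡⟨ reassociate ((+ 2 * K + + 1) * IBSeq (suc ν) k) ((+ 2 * N - + 2 * K + + 1) * shift (IBSeq (suc ν)) k)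
           ((N - + 1 + + 2 * K * (K + + 1)) * IBSeq ν k)
           ((+ 2 * (N - + 1) + + 4 * (N - K - + 1) * (K - + 1)) * shift (IBSeq ν) k)
           (((+ 2 * N - + 3) * (N - + 1) + + 2 * (K - + 2) * (K - + 2 * N + + 1)) * shift (shift (IBSeq ν)) k) ⟩
    rhs (shift (IBSeq (suc ν)) k) (shift (IBSeq ν) k) (shift (shift (IBSeq ν)) k)
      ≡⟨ cong₂ (rhs (shift (IBSeq (suc ν)) k)) (IB-shift ν k) (IB-shift² ν k) ⟨
    rhs (shift (IBSeq (suc ν)) k) (+ IB ν (K - + 1)) (+ IB ν (K - + 2))
      ≡⟨ cong (λ x → rhs x (+ IB ν (K - + 1)) (+ IB ν (K - + 2))) (IB-shift (suc ν) k) ⟨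
    rhs (+ IB (suc ν) (K - + 1)) (+ IB ν (K - + 1)) (+ IB ν (K - + 2)) ∎
    where
    open ≡-Reasoning
    N K : ℤ
    N = + (2 ℕ.+ ν)
    K = + k

    rhs : ℤ → ℤ → ℤ → ℤ
    rhs x y z = (+ 2 * K + + 1) * IBSeq (suc ν) k
      + (+ 2 * N - + 2 * K + + 1) * x
      + (N - + 1 + + 2 * K * (K + + 1)) * IBSeq ν k
      + (+ 2 * (N - + 1) + + 4 * (N - K - + 1) * (K - + 1)) * y
      + ((+ 2 * N - + 3) * (N - + 1) + + 2 * (K - + 2) * (K - + 2 * N + + 1)) * z
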